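{- Let $q$ be a complex variable with $|q|<1$ (equivalently, work with formal power series in $q$), and let \[ S(q):=\sum_{n\ge 0}\frac{\left(q;q^2\right)^2_n\, q^{2n}}{\left(-q^2;q^2\right)_n}. \] Then \[ \left(\left(q^4;q^4\right)_{\infty}S(q)\right)\Bigm| S_{2,0}=\sum_{n\ge 0}(-1)^nq^{6n^2+4n}\left(1+q^{4n+2}\right)\sum_{|j|\le n}(-1)^{j}q^{ -2j^2}, \] where the inner sum runs over integers $j$ with $|j|\le n$.
   Context: For $n\in\mathbb{N}_0\cup\{\infty\}$, $(a;q)_n:=\prod_{j=0}^{n-1}(1-aq^j)$, and $(a_1,a_2;q)_n:=(a_1;q)_n(a_2;q)_n$; $(a;q)_n^2$ denotes $((a;q)_n)^2$. For $N\in\mathbb{N}$, $r\in\mathbb{Z}$, the sieving operator $S_{N,r}$ acts on a power series $f(q)=\sum_{n\ge0}c(n)q^n$ by $f(q)\mid S_{N,r}:=\sum_{n\equiv r \pmod N}c(n)q^n$. -}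

module Defs where

open import Data.Nat as ℕ using (ℕ; zero; suc; _∸_; NonZero)
open import Data.Nat.DivMod using (_%_)
open import Data.Integer using (ℤ; +_; -_; _+_; _*_; _-_; ∣_∣; -[1+_])
open import Data.List using (List; []; _∷_)
open import Relation.Nullary using (yes; no)

-- Formal power series in q with integer coefficients: n ↦ [q^n] f.
PS : Set
PS = ℕ → ℤ

sumTo : (ℕ → ℤ) → ℕ → ℤ
sumTo f zero    = f 0
sumTo f (suc n) = sumTo f n + f (suc n)

sgn : ℕ → ℤ
sgn zero    = + 1
sgn (suc k) = - sgn k

one : PS
one zero    = + 1
one (suc _) = + 0

mono : ℤ → ℕ → PS
mono c e n with n ℕ.≟ e
... | yes _ = c
... | no  _ = + 0

_⊕_ : PS → PS → PS
(f ⊕ g) n = f n + g n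

_⊖_ : PS → PS → PS
(f ⊖ g) n = f n - g n

_⊗_ : PS → PS → PS
(f ⊗ g) n = sumTo (λ k → f k * g (n ∸ k)) n

infixl 6 _⊕_ _⊖_
infixl 7 _⊗_

sumPS : (ℕ → PS) → ℕ → PS
sumPS F n m = sumTo (λ k → F k m) n

prodPS : (ℕ → PS) → ℕ → PS
prodPS F zero    = one
prodPS F (suc n) = prodPS F n ⊗ F n

poch : ℤ → ℕ → ℕ → ℕ → PS
poch a b c n = prodPS (λ j → one ⊖ mono a (b ℕ.+ c ℕ.* j)) n

-- (a q^b ; q^c)_∞ for b, c ≥ 1: the coefficient of q^m is that of the
-- finite product with m+1 factors (later factors are 1 + O(q^{m+1})).
pochInf : ℤ → ℕ → ℕ → PS
pochInf a b c m = poch a b c (suc m) m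

-- Multiplicative inverse of a series f with constant term 1.
-- invList f n = [c_n , c_{n-1} , … , c_0] with c_0 = 1 and
-- c_{n} = - Σ_{k=1}^{n} f k * c_{n-k}.
private
  weighted : PS → ℕ → List ℤ → ℤ
  weighted f i []       = + 0
  weighted f i (x ∷ xs) = f (suc i) * x + weighted f (suc i) xs

invList : PS → ℕ → List ℤ
invList f zero    = + 1 ∷ []
invList f (suc n) = let prev = invList f n in (- weighted f 0 prev) ∷ prev

inv : PS → PS
inv f n with invList f n
... | []    = + 0
... | x ∷ _ = x

-- Σ_{n ≥ 0} t n, for a family where t n has q-adic order ≥ n
-- (so only n ≤ m contribute to the coefficient of q^m).
seriesSum : (ℕ → PS) → PS
seriesSum t m = sumTo (λ n → t n m) m

sieve : (N r : ℕ) → .{{NonZero N}} → PS → PS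
sieve N r f m with m % N ℕ.≟ r % N
... | yes _ = f m
... | no  _ = + 0

S : PS
S = seriesSum (λ n → poch (+ 1) 1 2 n ⊗ poch (+ 1) 1 2 n ⊗ mono (+ 1) (2 ℕ.* n)
                       ⊗ inv (poch (- (+ 1)) 2 2 n))

LHS : PS
LHS = sieve 2 0 (pochInf (+ 1) 4 4 ⊗ S)

-- (-1)^n q^{6n^2+4n} Σ_{|j|≤n} (-1)^j q^{-2j^2}, with j = k - n for k = 0..2n;
-- the exponent 6n^2+4n-2j^2 ≥ 4n^2+4n ≥ 0, so truncated subtraction is exact.
innerTerm : ℕ → PS
innerTerm n = sumPS (λ k → let j = ∣ + k - + n ∣ in
                           mono (sgn n * sgn j) ((6 ℕ.* n ℕ.* n ℕ.+ 4 ℕ.* n) ∸ (2 ℕ.* j ℕ.* j)))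
                    (2 ℕ.* n)

RHS : PS
RHS = seriesSum (λ n → (one ⊕ mono (+ 1) (4 ℕ.* n ℕ.+ 2)) ⊗ innerTerm n)

{-# OPTIONS --safe #-}
module Submission where

-- Write x = q². The finite Jacobi triple product gives
--   (q;q²)_n² = (x;x)_{2n} Σ_j (-1)^j q^{j²} / ((x;x)_{n-j} (x;x)_{n+j}),
-- so the even part of S is obtained by keeping the even j. With
--   c_n = (x;x)_{2n} / (-x;x)_n = (x;x²)_n (x;x)_n,
--   G(m) = Σ_n xⁿ c_n / ((x;x)_{n-m} (x;x)_{n+m}),
-- the sum G(m) + x^{3m+3} G(m+2) telescopes, with value x^m (1 + x^{m+1}) / (x²;x²)_∞.
-- Iterating this relation over m = 0, 2, 4, … turns Σ_k x^{2k²} G(2k) into the Hecke-type double sum.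
-- To avoid limits, the coefficient of q^M is computed modulo q^{M+1}, where all sums and products are finite.

open import Algebra.Bundles using (CommutativeRing)
import Algebra.Properties.Ring as RingProperties
import Algebra.Properties.Semiring.Mult.TCOptimised as Mult
import Algebra.Solver.Ring as RingSolver
open import Algebra.Solver.Ring.AlmostCommutativeRing using (_-Raw-AlmostCommutative⟶_; fromCommutativeRing)
open import Data.Empty using (⊥-elim)
open import Data.Integer as ℤ using (ℤ; +_; -[1+_])
import Data.Integer.Properties as ℤ
import Data.Integer.Tactic.RingSolver as ℤSolver
open import Data.List using (List; []; _∷_)
open import Data.Maybe.Base as Maybe using ()
open import Data.Nat as ℕ using (ℕ; zero; suc; _∸_; z≤n; s≤s)
open import Data.Nat.DivMod using (_%_)
import Data.Nat.Properties as ℕ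
open import Data.Nat.Tactic.RingSolver using (solve-∀)
open import Data.Product using (_×_; _,_; ∃; proj₁; proj₂)
open import Data.Sum using (_⊎_; inj₁; inj₂)
open import Defs
open import Function using (_∘_)
open import Level using (0ℓ)
open import Relation.Binary.PropositionalEquality as ≡ using (_≡_; cong)
import Relation.Binary.Reasoning.Setoid as SetoidReasoning
open import Relation.Nullary using (yes; no)
open import Relation.Nullary.Decidable using (dec⇒maybe)

-- The exponents of the double sum come from the iteration. Passing from m = 2n to m = 2n+2
-- multiplies by -x^{6n+3}, and x^{6n+3} = q^{6(n+1)²-6n²}. The term q^{4k²} of the triple product
-- enters at step k and so reaches step n as (-1)^{n-k} q^{6n²-2k²}. The value x^{2n}(1 + x^{2n+1})
-- contributes q^{4n}(1 + q^{4n+2}). The triple product and the telescoping both rest on termwise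
-- certificates, checked as polynomial identities by a ring solver. Two obstacles fix their form.
-- Modulo q^{M+1} the element q is nilpotent, so an identity cannot be divided by a power of q. And
-- x^{n-m} makes sense only for m ≤ n: there x^n = x^m x^{n-m} makes everything polynomial, while
-- for n < m every term vanishes along with 1/(x;x)_{n-m}.

-- A ring solver with integer coefficients over any commutative ring

module IntegerCoefficients (R : CommutativeRing 0ℓ 0ℓ) where
  open CommutativeRing R
  open RingProperties ring
  open Mult semiring renaming (_×_ to _×′_)
  open SetoidReasoning setoid

  -- Equality in `R` need not be decidable, so normal forms carry integer coefficients, which can be
  -- compared and cancelled.
  fromℤ : ℤ → Carrier
  fromℤ (+ n)    = n ×′ 1#
  fromℤ -[1+ n ] = - (suc n ×′ 1#)

  fromℤ-neg : ∀ i → fromℤ (ℤ.- i) ≈ - fromℤ i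
  fromℤ-neg (+ zero)  = sym -0#≈0#
  fromℤ-neg (+ suc n) = refl
  fromℤ-neg -[1+ n ]  = sym (-‿involutive _)

  fromℤ-⊖ : ∀ m n → fromℤ (m ℤ.⊖ n) ≈ m ×′ 1# - n ×′ 1#
  fromℤ-⊖ zero    zero    = sym (-‿inverseʳ _)
  fromℤ-⊖ zero    (suc n) = sym (+-identityˡ _)
  fromℤ-⊖ (suc m) zero    = sym (trans (+-congˡ -0#≈0#) (+-identityʳ _))
  fromℤ-⊖ (suc m) (suc n) = begin
    fromℤ (suc m ℤ.⊖ suc n)               ≡⟨ cong fromℤ (ℤ.[1+m]⊖[1+n]≡m⊖n m n) ⟩
    fromℤ (m ℤ.⊖ n)                       ≈⟨ fromℤ-⊖ m n ⟩
    m ×′ 1# - n ×′ 1#                       ≈⟨ +-identityˡ _ ⟨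
    0# + (m ×′ 1# - n ×′ 1#)                ≈⟨ +-congʳ (-‿inverseʳ 1#) ⟨
    (1# - 1#) + (m ×′ 1# - n ×′ 1#)         ≈⟨ +-assoc _ _ _ ⟩
    1# + (- 1# + (m ×′ 1# - n ×′ 1#))       ≈⟨ +-congˡ (trans (sym (+-assoc _ _ _)) (+-congʳ (+-comm _ _))) ⟩
    1# + ((m ×′ 1# - 1#) - n ×′ 1#)         ≈⟨ +-congˡ (+-assoc _ _ _) ⟩
    1# + (m ×′ 1# + (- 1# - n ×′ 1#))       ≈⟨ +-assoc _ _ _ ⟨
    (1# + m ×′ 1#) + (- 1# - n ×′ 1#)       ≈⟨ +-congˡ (-‿+-comm _ _) ⟩
    (1# + m ×′ 1#) - (1# + n ×′ 1#)         ≈⟨ +-cong (1+× m 1#) (-‿cong (1+× n 1#)) ⟨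
    suc m ×′ 1# - suc n ×′ 1#               ∎

  fromℤ-+ : ∀ i j → fromℤ (i ℤ.+ j) ≈ fromℤ i + fromℤ j
  fromℤ-+ (+ m)    (+ n)    = ×-homo-+ 1# m n
  fromℤ-+ (+ m)    -[1+ n ] = fromℤ-⊖ m (suc n)
  fromℤ-+ -[1+ m ] (+ n)    = trans (fromℤ-⊖ n (suc m)) (+-comm _ _)
  fromℤ-+ -[1+ m ] -[1+ n ] = begin
    - (suc (suc (m ℕ.+ n)) ×′ 1#)    ≡⟨ cong (λ k → - (k ×′ 1#)) (cong suc (ℕ.+-suc m n)) ⟨
    - ((suc m ℕ.+ suc n) ×′ 1#)      ≈⟨ -‿cong (×-homo-+ 1# (suc m) (suc n)) ⟩
    - (suc m ×′ 1# + suc n ×′ 1#)     ≈⟨ -‿+-comm _ _ ⟨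
    - (suc m ×′ 1#) - suc n ×′ 1#     ∎

  fromℤ-*-pos : ∀ m n → fromℤ (+ m ℤ.* + n) ≈ fromℤ (+ m) * fromℤ (+ n)
  fromℤ-*-pos m n = trans (reflexive (cong fromℤ (≡.sym (ℤ.pos-* m n)))) (×1-homo-* m n)

  fromℤ-* : ∀ i j → fromℤ (i ℤ.* j) ≈ fromℤ i * fromℤ j
  fromℤ-* (+ m)    (+ n)    = fromℤ-*-pos m n
  fromℤ-* (+ m)    -[1+ n ] = begin
    fromℤ (+ m ℤ.* -[1+ n ])             ≡⟨ cong fromℤ (ℤ.neg-distribʳ-* (+ m) (+ suc n)) ⟨
    fromℤ (ℤ.- (+ m ℤ.* + suc n))        ≈⟨ fromℤ-neg (+ m ℤ.* + suc n) ⟩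
    - fromℤ (+ m ℤ.* + suc n)            ≈⟨ -‿cong (fromℤ-*-pos m (suc n)) ⟩
    - (m ×′ 1# * (suc n ×′ 1#))            ≈⟨ -‿distribʳ-* _ _ ⟩
    m ×′ 1# * - (suc n ×′ 1#)              ∎
  fromℤ-* -[1+ m ] j        = begin
    fromℤ (-[1+ m ] ℤ.* j)               ≡⟨ cong fromℤ (ℤ.neg-distribˡ-* (+ suc m) j) ⟨
    fromℤ (ℤ.- (+ suc m ℤ.* j))          ≈⟨ fromℤ-neg (+ suc m ℤ.* j) ⟩
    - fromℤ (+ suc m ℤ.* j)              ≈⟨ -‿cong (pos j) ⟩
    - (suc m ×′ 1# * fromℤ j)             ≈⟨ -‿distribˡ-* _ _ ⟩
    - (suc m ×′ 1#) * fromℤ j             ∎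
    where
    pos : ∀ j → fromℤ (+ suc m ℤ.* j) ≈ fromℤ (+ suc m) * fromℤ j
    pos (+ n)    = fromℤ-*-pos (suc m) n
    pos -[1+ n ] = fromℤ-* (+ suc m) -[1+ n ]

  fromℤ-morphism : ℤ.+-*-rawRing -Raw-AlmostCommutative⟶ fromCommutativeRing R
  fromℤ-morphism = record
    { ⟦_⟧    = fromℤ
    ; +-homo = fromℤ-+
    ; *-homo = fromℤ-*
    ; -‿homo = fromℤ-neg
    ; 0-homo = refl
    ; 1-homo = refl
    }

  open RingSolver ℤ.+-*-rawRing (fromCommutativeRing R) fromℤ-morphism
    (λ i j → Maybe.map (λ i≡j → reflexive (cong fromℤ i≡j)) (dec⇒maybe (i ℤ.≟ j))) public
    using (solve; _:=_; _:+_; _:*_; _:-_; :-_; con)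

-- Finite sums and products

module Sums (R : CommutativeRing 0ℓ 0ℓ) where
  open CommutativeRing R
  open IntegerCoefficients R
  open SetoidReasoning setoid

  ∑ : ℕ → (ℕ → Carrier) → Carrier
  ∑ zero    f = 0#
  ∑ (suc n) f = ∑ n f + f n

  ∑-cong : ∀ n {f g} → (∀ i → i ℕ.< n → f i ≈ g i) → ∑ n f ≈ ∑ n g
  ∑-cong zero    f≈g = refl
  ∑-cong (suc n) f≈g = +-cong (∑-cong n λ i i<n → f≈g i (ℕ.m<n⇒m<1+n i<n)) (f≈g n ℕ.≤-refl)

  ∑-zero : ∀ n {f} → (∀ i → i ℕ.< n → f i ≈ 0#) → ∑ n f ≈ 0#
  ∑-zero zero    f≈0 = refl
  ∑-zero (suc n) f≈0 =
    trans (+-cong (∑-zero n λ i i<n → f≈0 i (ℕ.m<n⇒m<1+n i<n)) (f≈0 n ℕ.≤-refl)) (+-identityʳ 0#)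

  ∑-head : ∀ n f → ∑ (suc n) f ≈ f 0 + ∑ n (λ i → f (suc i))
  ∑-head zero    f = +-comm 0# (f 0)
  ∑-head (suc n) f = trans (+-congʳ (∑-head n f)) (+-assoc _ _ _)

  ∑-+ : ∀ n f g → ∑ n (λ i → f i + g i) ≈ ∑ n f + ∑ n g
  ∑-+ zero    f g = sym (+-identityʳ 0#)
  ∑-+ (suc n) f g = trans (+-congʳ (∑-+ n f g))
    (solve 4 (λ a b c d → (a :+ b) :+ (c :+ d) := (a :+ c) :+ (b :+ d)) refl (∑ n f) (∑ n g) (f n) (g n))

  ∑-*ˡ : ∀ n a f → a * ∑ n f ≈ ∑ n (λ i → a * f i)
  ∑-*ˡ zero    a f = zeroʳ a
  ∑-*ˡ (suc n) a f = trans (distribˡ a _ _) (+-congʳ (∑-*ˡ n a f))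

  ∑-swap : ∀ m n (f : ℕ → ℕ → Carrier) → ∑ m (λ i → ∑ n (f i)) ≈ ∑ n (λ j → ∑ m (λ i → f i j))
  ∑-swap zero    n f = sym (∑-zero n λ _ _ → refl)
  ∑-swap (suc m) n f = trans (+-congʳ (∑-swap m n f)) (sym (∑-+ n _ _))

  ∑-even-odd : ∀ n f → ∑ (n ℕ.+ n) f ≈ ∑ n (λ i → f (i ℕ.+ i)) + ∑ n (λ i → f (suc (i ℕ.+ i)))
  ∑-even-odd zero    f = sym (+-identityʳ 0#)
  ∑-even-odd (suc n) f rewrite ℕ.+-suc n n = trans (+-congʳ (+-congʳ (∑-even-odd n f)))
    (solve 4 (λ a b c d → ((a :+ b) :+ c) :+ d := (a :+ c) :+ (b :+ d)) refl _ _ _ _)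

  ∏ : ℕ → (ℕ → Carrier) → Carrier
  ∏ zero    f = 1#
  ∏ (suc n) f = ∏ n f * f n

-- Truncated power series, axiomatically

-- The algebra sees series only through this interface. `q^-small` is what replaces limits: beyond
-- the precision, powers of q are equal to 0, so infinite products and sums become finite ones.
record SeriesRing : Set₁ where
  field
    commutativeRing : CommutativeRing 0ℓ 0ℓ
  open CommutativeRing commutativeRing public hiding (zero)
  open RingProperties ring public
  open IntegerCoefficients commutativeRing public
  open Sums commutativeRing public
  field
    q^_ : ℕ → Carrier
    q^0 : q^ 0 ≈ 1#
    q^+ : ∀ a b → q^ (a ℕ.+ b) ≈ q^ a * q^ b
    precision : ℕ
    q^-small : ∀ {e} → precision ℕ.< e → q^ e ≈ 0#

  infix 9 q^_ x^_

  q : Carrier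
  q = q^ 1

  x^_ : ℕ → Carrier
  x^ n = q^ (2 ℕ.* n)

  ⟨q,q²⟩ : ℕ → Carrier
  ⟨q,q²⟩ n = ∏ n λ j → 1# - q * x^ j

  ⟨x,x⟩ : ℕ → Carrier
  ⟨x,x⟩ n = ∏ n λ j → 1# - x^ (suc j)

  ⟨-x,x⟩ : ℕ → Carrier
  ⟨-x,x⟩ n = ∏ n λ j → 1# + x^ (suc j)

  ⟨x,x²⟩ : ℕ → Carrier
  ⟨x,x²⟩ n = ∏ n λ j → 1# - x^ (suc (j ℕ.+ j))

  ⟨x²,x²⟩ : ℕ → Carrier
  ⟨x²,x²⟩ n = ∏ n λ j → 1# - x^ (suc j ℕ.+ suc j)

  field
    1/⟨x,x⟩ 1/⟨-x,x⟩ : ℕ → Carrier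
    ⟨x,x⟩-inverse  : ∀ n → ⟨x,x⟩ n * 1/⟨x,x⟩ n ≈ 1#
    ⟨-x,x⟩-inverse : ∀ n → ⟨-x,x⟩ n * 1/⟨-x,x⟩ n ≈ 1#

    -- q ↦ -q, which separates even and odd powers of q.
    σ : Carrier → Carrier
    σ-cong : ∀ {f g} → f ≈ g → σ f ≈ σ g
    σ-+ : ∀ f g → σ (f + g) ≈ σ f + σ g
    σ-* : ∀ f g → σ (f * g) ≈ σ f * σ g
    σ-1 : σ 1# ≈ 1#
    σ-q : σ q ≈ - q

-- Powers of x and reciprocals of (x;x)_n

module Core (𝓡 : SeriesRing) where
  open SeriesRing 𝓡
  open SetoidReasoning setoid

  private
    v : ℕ → Carrier
    v = 1/⟨x,x⟩

  1-_ : ∀ {f g} → f ≈ g → 1# - f ≈ 1# - g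
  1- f≈g = +-congˡ (-‿cong f≈g)

  infix 5 1-_

  *-vanish : ∀ a b c {d} → d ≈ 0# → a * (b * (d * c)) ≈ 0#
  *-vanish a b c d≈0 = trans (*-congˡ (*-congˡ (*-congʳ d≈0)))
    (solve 3 (λ a b c → a :* (b :* (con (+ 0) :* c)) := con (+ 0)) refl a b c)

  x^+ : ∀ a b → x^ (a ℕ.+ b) ≈ x^ a * x^ b
  x^+ a b = trans (reflexive (cong q^_ (ℕ.*-distribˡ-+ 2 a b))) (q^+ (2 ℕ.* a) (2 ℕ.* b))

  x^suc : ∀ n → x^ (suc n) ≈ q * q * x^ n
  x^suc n = trans (x^+ 1 n) (*-congʳ (q^+ 1 1))

  x^[1+n+n] : ∀ n → x^ (suc (n ℕ.+ n)) ≈ q * q * (x^ n * x^ n)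
  x^[1+n+n] n = trans (x^suc (n ℕ.+ n)) (*-congˡ (x^+ n n))

  x^[2+n+m] : ∀ n m → x^ (suc (suc (n ℕ.+ m))) ≈ q * q * (q * q * (x^ n * x^ m))
  x^[2+n+m] n m = trans (x^suc (suc (n ℕ.+ m))) (*-congˡ (trans (x^suc (n ℕ.+ m)) (*-congˡ (x^+ n m))))

  ⟨x,x⟩-double : ∀ n → ⟨x,x⟩ (n ℕ.+ n) ≈ ⟨x,x²⟩ n * ⟨x²,x²⟩ n
  ⟨x,x⟩-double zero = sym (*-identityʳ 1#)
  ⟨x,x⟩-double (suc n) rewrite ℕ.+-suc n n = trans (*-congʳ (*-congʳ (⟨x,x⟩-double n)))
    (solve 4 (λ a b c d → a :* b :* c :* d := (a :* c) :* (b :* d)) refl _ _ _ _)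

  ⟨x²,x²⟩-split : ∀ n → ⟨x²,x²⟩ n ≈ ⟨x,x⟩ n * ⟨-x,x⟩ n
  ⟨x²,x²⟩-split zero    = sym (*-identityʳ 1#)
  ⟨x²,x²⟩-split (suc n) = trans (*-cong (⟨x²,x²⟩-split n) (1- x^+ (suc n) (suc n)))
    (solve 3 (λ a b c → a :* b :* (con (+ 1) :- c :* c) := a :* (con (+ 1) :- c) :* (b :* (con (+ 1) :+ c)))
      refl _ _ _)

  v-step : ∀ n → v n ≈ (1# - x^ (suc n)) * v (suc n)
  v-step n = begin
    v n                                              ≈⟨ *-identityʳ _ ⟨
    v n * 1#                                         ≈⟨ *-congˡ (⟨x,x⟩-inverse (suc n)) ⟨
    v n * (⟨x,x⟩ n * (1# - x^ (suc n)) * v (suc n))  ≈⟨ solve 4 (λ a b c d → a :* (b :* c :* d) := b :* a :* (c :* d)) refl _ _ _ _ ⟩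
    ⟨x,x⟩ n * v n * ((1# - x^ (suc n)) * v (suc n))  ≈⟨ *-congʳ (⟨x,x⟩-inverse n) ⟩
    1# * ((1# - x^ (suc n)) * v (suc n))             ≈⟨ *-identityˡ _ ⟩
    (1# - x^ (suc n)) * v (suc n)                    ∎

  v-step² : ∀ n m → v (n ℕ.+ m) ≈ (1# - q * q * (x^ n * x^ m)) * ((1# - q * q * (q * q * (x^ n * x^ m))) * v (suc (suc (n ℕ.+ m))))
  v-step² n m = trans (v-step (n ℕ.+ m)) (*-cong (1- trans (x^suc (n ℕ.+ m)) (*-congˡ (x^+ n m)))
    (trans (v-step (suc (n ℕ.+ m))) (*-congʳ (1- x^[2+n+m] n m))))

  -- 1/(x;x)_{n-m}, read as 0 when n < m.
  D : ℕ → ℕ → Carrier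
  D n       zero    = v n
  D zero    (suc m) = 0#
  D (suc n) (suc m) = D n m

  -- Truncated subtraction is harmless here: for n = m the factor is 1 - x^0 = 0, and for n < m both
  -- sides vanish.
  D-step : ∀ n m → D n (suc m) ≈ (1# - x^ (n ∸ m)) * D n m
  D-step zero    zero    = sym (trans (*-congʳ (trans (1- q^0) (-‿inverseʳ 1#))) (zeroˡ _))
  D-step zero    (suc m) = sym (zeroʳ _)
  D-step (suc n) zero    = v-step n
  D-step (suc n) (suc m) = D-step n m

  D-< : ∀ {n m} → n ℕ.< m → D n m ≈ 0#
  D-< {zero}  {suc m} _         = refl
  D-< {suc n} {suc m} (s≤s n<m) = D-< n<m

  D-≥ : ∀ m k → D (m ℕ.+ k) m ≈ v k
  D-≥ zero    k = refl
  D-≥ (suc m) k = D-≥ m k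

  x^-∸ : ∀ {n m} → m ℕ.≤ n → x^ n ≈ x^ m * x^ (n ∸ m)
  x^-∸ {n} {m} m≤n = trans (reflexive (cong x^_ (≡.sym (ℕ.m+[n∸m]≡n m≤n)))) (x^+ m (n ∸ m))

  -- The finite Jacobi triple product

  sign : ℕ → Carrier
  sign zero    = 1#
  sign (suc k) = - sign k

  q^-suc-square : ∀ j → q^ (suc j ℕ.* suc j) ≈ q^ (j ℕ.* j) * x^ j * q
  q^-suc-square j = trans (reflexive (cong q^_ (expand j)))
    (trans (q^+ _ 1) (*-congʳ (q^+ _ _)))
    where
    expand : ∀ j → suc j ℕ.* suc j ≡ j ℕ.* j ℕ.+ 2 ℕ.* j ℕ.+ 1
    expand = solve-∀

  2# : Carrier
  2# = 1# + 1#

  -- The weight of q^{j²} when the sum over j ∈ ℤ is folded onto j ≥ 0.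
  weight : ℕ → Carrier
  weight zero    = 1#
  weight (suc j) = 2# * (sign (suc j) * q^ (suc j ℕ.* suc j))

  reciprocal : ℕ → ℕ → Carrier
  reciprocal n j = D n j * v (n ℕ.+ j)

  jacobi : ℕ → ℕ → Carrier
  jacobi J n = ∑ (suc J) λ j → weight j * reciprocal n j

  -- A q-Zeilberger certificate: the recurrence in n for the sum over j holds termwise up to
  -- twice the difference of its values at j and j - 1.
  certificate : ℕ → ℕ → Carrier
  certificate n j = (1# - q * x^ n) * x^ n * (sign j * (q^ (suc j ℕ.* suc j) * q + q^ (j ℕ.* j) * q))
    * (D n j * v (suc n ℕ.+ j))

  -- Here a = x^i, b = x^{n-i}, A = q^{i²}, s = (-1)^i, d = 1/(x;x)_{n-i} and u = 1/(x;x)_{n+i+2},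
  -- all treated as independent letters.
  certificate-≤ : ∀ q a b A s d u → let y = a * b in
    (1# - q * q * (y * y)) * (1# - q * q * (q * q * (y * y))) * (2# * (- s * (A * a * q)) * (d * u))
      + 2# * ((1# - q * y) * y * (s * (A * a * q * q + A * q)) * (d * ((1# - q * q * (q * q * (y * a))) * u)))
    ≈ (1# - q * y) * (1# - q * y) * (2# * (- s * (A * a * q)) * ((1# - b) * d * ((1# - q * q * (q * q * (y * a))) * u)))
      + 2# * ((1# - q * y) * y * (- s * (A * a * q * (q * q * a) * q * q + A * a * q * q)) * ((1# - b) * d * u))
  certificate-≤ = solve 7 (λ q a b A s d u → let y = a :* b ; o = con (+ 1) ; t = o :+ o in
    (o :- q :* q :* (y :* y)) :* (o :- q :* q :* (q :* q :* (y :* y))) :* (t :* (:- s :* (A :* a :* q)) :* (d :* u))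
      :+ t :* ((o :- q :* y) :* y :* (s :* (A :* a :* q :* q :+ A :* q)) :* (d :* ((o :- q :* q :* (q :* q :* (y :* a))) :* u)))
    := (o :- q :* y) :* (o :- q :* y) :* (t :* (:- s :* (A :* a :* q)) :* ((o :- b) :* d :* ((o :- q :* q :* (q :* q :* (y :* a))) :* u)))
      :+ t :* ((o :- q :* y) :* y :* (:- s :* (A :* a :* q :* (q :* q :* a) :* q :* q :+ A :* a :* q :* q)) :* ((o :- b) :* d :* u))) refl

  certificate-step : ∀ n i → let j = suc i in
    (1# - x^ (suc (n ℕ.+ n))) * (1# - x^ (suc (suc (n ℕ.+ n)))) * (weight j * reciprocal (suc n) j)
      + 2# * certificate n i
    ≈ (1# - q * x^ n) * (1# - q * x^ n) * (weight j * reciprocal n j) + 2# * certificate n j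
  certificate-step n i with ℕ.≤-<-connex i n
  ... | inj₂ n<i = trans (+-cong (*-vanish _ _ _ d≈0) (*-vanish _ _ _ d≈0))
                        (sym (+-cong (*-vanish _ _ _ d′≈0) (*-vanish _ _ _ d′≈0)))
    where
    d≈0 : D n i ≈ 0#
    d≈0 = D-< n<i
    d′≈0 : D n (suc i) ≈ 0#
    d′≈0 = D-< (ℕ.m<n⇒m<1+n n<i)
  ... | inj₁ i≤n rewrite ℕ.+-suc n i = trans lhs (trans (certificate-≤ q a b A s d u) (sym rhs))
    where
    a = x^ i
    b = x^ (n ∸ i)
    A = q^ (i ℕ.* i)
    s = sign i
    d = D n i
    u = v (suc (suc (n ℕ.+ i)))
    y≈ab : x^ n ≈ a * b
    y≈ab = x^-∸ i≤n
    W : weight (suc i) ≈ 2# * (- s * (A * a * q))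
    W = *-congˡ (*-congˡ (q^-suc-square i))
    v-next : v (suc (n ℕ.+ i)) ≈ (1# - q * q * (q * q * (a * b * a))) * u
    v-next = trans (v-step (suc (n ℕ.+ i))) (*-congʳ (1- trans (x^[2+n+m] n i) (*-congˡ (*-congˡ (*-congʳ y≈ab)))))
    y² : x^ n * x^ n ≈ (a * b) * (a * b)
    y² = *-cong y≈ab y≈ab
    factor : (1# - q * x^ n) ≈ (1# - q * (a * b))
    factor = 1- *-congˡ y≈ab
    lhs = +-cong
      (*-cong (*-cong (1- trans (x^[1+n+n] n) (*-congˡ y²)) (1- trans (x^[2+n+m] n n) (*-congˡ (*-congˡ y²))))
              (*-congʳ W))
      (*-congˡ (*-cong (*-cong (*-cong factor y≈ab) (*-congˡ (+-congʳ (*-congʳ (q^-suc-square i)))))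
                       (*-congˡ v-next)))
    rhs = +-cong
      (*-cong (*-cong factor factor) (*-cong W (*-cong (D-step n i) v-next)))
      (*-congˡ (*-cong (*-cong (*-cong factor y≈ab)
                               (*-congˡ (+-cong (*-congʳ (trans (q^-suc-square (suc i))
                                                  (*-congʳ (*-cong (q^-suc-square i) (x^suc i)))))
                                                (*-congʳ (q^-suc-square i)))))
                       (*-congʳ (D-step n i))))

  jacobi-step : ∀ J n →
    (1# - x^ (suc (n ℕ.+ n))) * (1# - x^ (suc (suc (n ℕ.+ n)))) * jacobi J (suc n)
    ≈ (1# - q * x^ n) * (1# - q * x^ n) * jacobi J n + 2# * certificate n J
  jacobi-step zero    n = trans lhs (trans key (sym rhs))
    where
    y = x^ n
    u = v (suc n)
    v-next : v n ≈ (1# - q * q * y) * u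
    v-next = trans (v-step n) (*-congʳ (1- x^suc n))
    v-+0 : ∀ n → v (n ℕ.+ 0) ≈ v n
    v-+0 n = reflexive (cong v (ℕ.+-identityʳ n))
    lhs = *-cong (*-cong (1- x^[1+n+n] n) (1- x^[2+n+m] n n)) (+-congˡ (*-congˡ (*-congˡ (v-+0 (suc n)))))
    rhs = +-cong (*-congˡ (+-congˡ (*-congˡ (*-cong v-next (trans (v-+0 n) v-next)))))
                 (*-congˡ (*-cong (*-congˡ (*-congˡ (+-congˡ (*-congʳ q^0)))) (*-cong v-next (v-+0 (suc n)))))
    -- The term j = 0 has weight 1 rather than 2 and lies outside `certificate-step`;
    -- `certificate n 0` is exactly what makes up the difference.
    key = solve 3 (λ q y u → let o = con (+ 1) ; z = con (+ 0) in
        (o :- q :* q :* (y :* y)) :* (o :- q :* q :* (q :* q :* (y :* y))) :* (z :+ o :* (u :* u))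
        := (o :- q :* y) :* (o :- q :* y) :* (z :+ o :* ((o :- q :* q :* y) :* u :* ((o :- q :* q :* y) :* u)))
          :+ (o :+ o) :* ((o :- q :* y) :* y :* (o :* (q :* q :+ o :* q)) :* ((o :- q :* q :* y) :* u :* u)))
      refl q y u
  jacobi-step (suc J) n = begin
    α * (jacobi J (suc n) + t (suc n))            ≈⟨ distribˡ _ _ _ ⟩
    α * jacobi J (suc n) + α * t (suc n)          ≈⟨ +-congʳ (jacobi-step J n) ⟩
    β * jacobi J n + 2# * certificate n J + α * t (suc n)
                                                  ≈⟨ solve 3 (λ a b c → a :+ b :+ c := a :+ (c :+ b)) refl _ _ _ ⟩
    β * jacobi J n + (α * t (suc n) + 2# * certificate n J)
                                                  ≈⟨ +-congˡ (certificate-step n J) ⟩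
    β * jacobi J n + (β * t n + 2# * certificate n (suc J))
                                                  ≈⟨ solve 4 (λ a b c d → a :* b :+ (a :* c :+ d) := a :* (b :+ c) :+ d) refl _ _ _ _ ⟩
    β * (jacobi J n + t n) + 2# * certificate n (suc J)
                                                  ∎
    where
    α = (1# - x^ (suc (n ℕ.+ n))) * (1# - x^ (suc (suc (n ℕ.+ n))))
    β = (1# - q * x^ n) * (1# - q * x^ n)
    t : ℕ → Carrier
    t n = weight (suc J) * reciprocal n (suc J)

  v-0 : v 0 ≈ 1#
  v-0 = trans (sym (*-identityˡ _)) (⟨x,x⟩-inverse 0)

  -- Induction on n by `jacobi-step`, whose boundary term contains 1/(x;x)_{n-J}, which is 0 for n <
  -- J. The cut-off J does not depend on n, so that the sums over n and j can be exchanged later.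
  finite-jacobi : ∀ {J} n → n ℕ.≤ J → ⟨x,x⟩ (n ℕ.+ n) * jacobi J n ≈ ⟨q,q²⟩ n * ⟨q,q²⟩ n
  finite-jacobi {J} zero    _   = *-congˡ (begin
    jacobi J 0                                        ≈⟨ ∑-head J _ ⟩
    1# * (v 0 * v 0) + ∑ J (λ j → weight (suc j) * (0# * v (suc j)))
                                                      ≈⟨ +-cong (trans (*-identityˡ _) (*-cong v-0 v-0))
                                                           (∑-zero J λ _ _ → trans (*-congˡ (zeroˡ _)) (zeroʳ _)) ⟩
    1# * 1# + 0#                                      ≈⟨ trans (+-identityʳ _) (*-identityʳ 1#) ⟩
    1#                                                ∎)
  finite-jacobi {J} (suc n) n<J rewrite ℕ.+-suc n n = begin
    ⟨x,x⟩ (n ℕ.+ n) * (1# - x^ (suc (n ℕ.+ n))) * (1# - x^ (suc (suc (n ℕ.+ n)))) * jacobi J (suc n)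
      ≈⟨ solve 4 (λ a b c d → a :* b :* c :* d := a :* (b :* c :* d)) refl _ _ _ _ ⟩
    ⟨x,x⟩ (n ℕ.+ n) * ((1# - x^ (suc (n ℕ.+ n))) * (1# - x^ (suc (suc (n ℕ.+ n)))) * jacobi J (suc n))
      ≈⟨ *-congˡ (trans (jacobi-step J n) (+-congˡ (*-vanish _ _ _ (D-< n<J)))) ⟩
    ⟨x,x⟩ (n ℕ.+ n) * ((1# - q * x^ n) * (1# - q * x^ n) * jacobi J n + 0#)
      ≈⟨ solve 3 (λ a b c → a :* (b :* b :* c :+ con (+ 0)) := a :* c :* (b :* b)) refl _ _ _ ⟩
    ⟨x,x⟩ (n ℕ.+ n) * jacobi J n * ((1# - q * x^ n) * (1# - q * x^ n))
      ≈⟨ *-congʳ (finite-jacobi n (ℕ.<⇒≤ n<J)) ⟩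
    ⟨q,q²⟩ n * ⟨q,q²⟩ n * ((1# - q * x^ n) * (1# - q * x^ n))
      ≈⟨ solve 2 (λ a b → a :* a :* (b :* b) := a :* b :* (a :* b)) refl _ _ ⟩
    ⟨q,q²⟩ n * (1# - q * x^ n) * (⟨q,q²⟩ n * (1# - q * x^ n)) ∎

  -- Expansion of S by the triple product

  c : ℕ → Carrier
  c n = ⟨x,x²⟩ n * ⟨x,x⟩ n

  ⟨x,x⟩-double/⟨-x,x⟩ : ∀ n → ⟨x,x⟩ (n ℕ.+ n) * 1/⟨-x,x⟩ n ≈ c n
  ⟨x,x⟩-double/⟨-x,x⟩ n = begin
    ⟨x,x⟩ (n ℕ.+ n) * 1/⟨-x,x⟩ n
      ≈⟨ *-congʳ (trans (⟨x,x⟩-double n) (*-congˡ (⟨x²,x²⟩-split n))) ⟩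
    ⟨x,x²⟩ n * (⟨x,x⟩ n * ⟨-x,x⟩ n) * 1/⟨-x,x⟩ n
      ≈⟨ solve 4 (λ a b c d → a :* (b :* c) :* d := a :* b :* (c :* d)) refl _ _ _ _ ⟩
    c n * (⟨-x,x⟩ n * 1/⟨-x,x⟩ n)
      ≈⟨ trans (*-congˡ (⟨-x,x⟩-inverse n)) (*-identityʳ _) ⟩
    c n ∎

  G : ℕ → ℕ → Carrier
  G N m = ∑ N λ n → x^ n * (c n * reciprocal n m)

  S-summand : ℕ → Carrier
  S-summand n = ⟨q,q²⟩ n * ⟨q,q²⟩ n * x^ n * 1/⟨-x,x⟩ n

  S-expansion : ∀ N J → N ℕ.≤ suc J → ∑ N S-summand ≈ ∑ (suc J) (λ j → weight j * G N j)
  S-expansion N J N≤J = begin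
    ∑ N S-summand
      ≈⟨ ∑-cong N summand ⟩
    ∑ N (λ n → ∑ (suc J) (λ j → weight j * (x^ n * (c n * reciprocal n j))))
      ≈⟨ ∑-swap N (suc J) _ ⟩
    ∑ (suc J) (λ j → ∑ N (λ n → weight j * (x^ n * (c n * reciprocal n j))))
      ≈⟨ ∑-cong (suc J) (λ j _ → ∑-*ˡ N (weight j) _) ⟨
    ∑ (suc J) (λ j → weight j * G N j) ∎
    where
    summand : ∀ n → n ℕ.< N → S-summand n ≈ ∑ (suc J) (λ j → weight j * (x^ n * (c n * reciprocal n j)))
    summand n n<N = begin
      ⟨q,q²⟩ n * ⟨q,q²⟩ n * x^ n * 1/⟨-x,x⟩ n
        ≈⟨ *-congʳ (*-congʳ (finite-jacobi n (ℕ.≤-pred (ℕ.≤-trans n<N N≤J)))) ⟨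
      ⟨x,x⟩ (n ℕ.+ n) * jacobi J n * x^ n * 1/⟨-x,x⟩ n
        ≈⟨ solve 4 (λ a b c d → a :* b :* c :* d := c :* (a :* d) :* b) refl _ _ _ _ ⟩
      x^ n * (⟨x,x⟩ (n ℕ.+ n) * 1/⟨-x,x⟩ n) * jacobi J n
        ≈⟨ *-congʳ (*-congˡ (⟨x,x⟩-double/⟨-x,x⟩ n)) ⟩
      x^ n * c n * jacobi J n
        ≈⟨ ∑-*ˡ (suc J) _ _ ⟩
      ∑ (suc J) (λ j → x^ n * c n * (weight j * reciprocal n j))
        ≈⟨ ∑-cong (suc J) (λ j _ → solve 4 (λ a b c d → a :* b :* (c :* d) := c :* (a :* (b :* d))) refl _ _ _ _) ⟩
      ∑ (suc J) (λ j → weight j * (x^ n * (c n * reciprocal n j))) ∎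

  -- The telescoping relation

  κ π : ℕ → Carrier
  κ m = x^ (suc m) * (x^ (suc m) * x^ (suc m))
  π m = x^ m * (1# + x^ (suc m))

  -- The factor q² = x makes the identity hold for n = m as well, where truncation gives x^ (n ∸ suc m) = 1.
  D-step² : ∀ {n m} → m ℕ.≤ n →
    q * q * D n (suc (suc m)) ≈ (q * q - x^ (n ∸ m)) * ((1# - x^ (n ∸ m)) * D n m)
  D-step² {n} {m} m≤n with ℕ.m≤n⇒m<n∨m≡n m≤n
  ... | inj₁ m<n = begin
    q * q * D n (suc (suc m))
      ≈⟨ *-congˡ (D-step n (suc m)) ⟩
    q * q * ((1# - x^ (n ∸ suc m)) * D n (suc m))
      ≈⟨ solve 3 (λ a b c → a :* ((con (+ 1) :- b) :* c) := (a :- a :* b) :* c) refl _ _ _ ⟩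
    (q * q - q * q * x^ (n ∸ suc m)) * D n (suc m)
      ≈⟨ *-cong (+-congˡ (-‿cong (sym (x^suc (n ∸ suc m))))) (D-step n m) ⟩
    (q * q - x^ (suc (n ∸ suc m))) * ((1# - x^ (n ∸ m)) * D n m)
      ≡⟨ cong (λ k → (q * q - x^ k) * ((1# - x^ (n ∸ m)) * D n m)) (≡.sym (ℕ.+-∸-assoc 1 m<n)) ⟩
    (q * q - x^ (n ∸ m)) * ((1# - x^ (n ∸ m)) * D n m) ∎
  ... | inj₂ ≡.refl = trans (trans (*-congˡ (D-< (ℕ.m<n⇒m<1+n (ℕ.n<1+n n)))) (zeroʳ _))
    (sym (trans (*-congˡ (trans (sym (D-step n n)) (D-< (ℕ.n<1+n n)))) (zeroʳ _)))

  -- Here a = x^m, b = x^{N-m}, A = (x;x²)_N, X = (x;x)_N, w = 1/(x;x)_{N+m+2} and d =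
  -- 1/(x;x)_{N-m}.
  telescope-≤ : ∀ q a b A X w d → let y = a * b in
    a * (1# + q * q * a) * (A * X * ((1# - b) * d * ((1# - q * q * (q * q * (y * a))) * w)))
      + (y * (A * X * (d * ((1# - q * q * (y * a)) * ((1# - q * q * (q * q * (y * a))) * w))))
         + (q * q * a) * (a * a) * (q * q) * (y * (A * X * w)) * ((q * q - b) * ((1# - b) * d)))
    ≈ a * (1# + q * q * a) * (A * (1# - q * q * (y * y)) * (X * (1# - q * q * y)) * (d * w))
  telescope-≤ = solve 7 (λ q a b A X w d → let y = a :* b ; o = con (+ 1) in
    a :* (o :+ q :* q :* a) :* (A :* X :* ((o :- b) :* d :* ((o :- q :* q :* (q :* q :* (y :* a))) :* w)))
      :+ (y :* (A :* X :* (d :* ((o :- q :* q :* (y :* a)) :* ((o :- q :* q :* (q :* q :* (y :* a))) :* w))))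
          :+ (q :* q :* a) :* (a :* a) :* (q :* q) :* (y :* (A :* X :* w)) :* ((q :* q :- b) :* ((o :- b) :* d)))
    := a :* (o :+ q :* q :* a) :* (A :* (o :- q :* q :* (y :* y)) :* (X :* (o :- q :* q :* y)) :* (d :* w))) refl

  -- Up to the factor `π m`, the antidifference in N of the combined summand: c_N / ((x;x)_{N-m-1}
  -- (x;x)_{N+m+1}). It is 0 at N = 0, so the partial sums equal it exactly.
  remainder : ℕ → ℕ → Carrier
  remainder N m = c N * (D N (suc m) * v (suc (N ℕ.+ m)))

  telescope-step : ∀ N m →
    π m * remainder N m + (x^ N * (c N * reciprocal N m) + κ m * (x^ N * (c N * reciprocal N (suc (suc m)))))
    ≈ π m * remainder (suc N) m
  telescope-step N m with ℕ.≤-<-connex m N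
  ... | inj₂ N<m = trans
    (+-cong (*-vanish _ _ _ (D-< (ℕ.m<n⇒m<1+n N<m)))
            (+-cong (*-vanish _ _ _ (D-< N<m))
                    (trans (*-congˡ (*-vanish _ _ _ (D-< (ℕ.m<n⇒m<1+n (ℕ.m<n⇒m<1+n N<m))))) (zeroʳ _))))
    (trans (trans (+-identityˡ _) (+-identityˡ _)) (sym (*-vanish _ _ _ (D-< N<m))))
  ... | inj₁ m≤N = trans lhs (trans (telescope-≤ q a b A X w d) (sym rhs))
    where
    a = x^ m
    b = x^ (N ∸ m)
    A = ⟨x,x²⟩ N
    X = ⟨x,x⟩ N
    w = v (suc (suc (N ℕ.+ m)))
    d = D N m
    y≈ab : x^ N ≈ a * b
    y≈ab = x^-∸ m≤N
    π≈ : π m ≈ a * (1# + q * q * a)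
    π≈ = *-congˡ (+-congˡ (x^suc m))
    third : κ m * (x^ N * (c N * reciprocal N (suc (suc m))))
      ≈ (q * q * a) * (a * a) * (q * q) * ((a * b) * (A * X * w)) * ((q * q - b) * ((1# - b) * d))
    third = begin
      κ m * (x^ N * (c N * (D N (suc (suc m)) * v (N ℕ.+ suc (suc m)))))
        ≈⟨ *-cong (*-cong (x^suc m) (*-cong (x^suc m) (x^suc m)))
             (*-cong y≈ab (*-congˡ (*-congˡ (reflexive (cong v (≡.trans (ℕ.+-suc N (suc m)) (cong suc (ℕ.+-suc N m)))))))) ⟩
      q * q * a * (q * q * a * (q * q * a)) * ((a * b) * (A * X * (D N (suc (suc m)) * w)))
        -- One factor q² of x^{3m+3} is set aside for `D-step²`, where it cannot be cancelled.
        ≈⟨ solve 7 (λ q a b A X w d → q :* q :* a :* (q :* q :* a :* (q :* q :* a)) :* ((a :* b) :* (A :* X :* (d :* w)))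
             := (q :* q :* a) :* (a :* a) :* (q :* q) :* ((a :* b) :* (A :* X :* w)) :* (q :* q :* d))
             refl q a b A X w (D N (suc (suc m))) ⟩
      (q * q * a) * (a * a) * (q * q) * ((a * b) * (A * X * w)) * (q * q * D N (suc (suc m)))
        ≈⟨ *-congˡ (D-step² m≤N) ⟩
      (q * q * a) * (a * a) * (q * q) * ((a * b) * (A * X * w)) * ((q * q - b) * ((1# - b) * d)) ∎
    lhs = +-cong
      (*-cong π≈ (*-congˡ (*-cong (D-step N m)
        (trans (v-step (suc (N ℕ.+ m))) (*-congʳ (1- trans (x^[2+n+m] N m) (*-congˡ (*-congˡ (*-congʳ y≈ab)))))))))
      (+-cong
        (*-cong y≈ab (*-congˡ (*-congˡ (trans (v-step² N m)
          (*-cong (1- *-congˡ (*-congʳ y≈ab)) (*-congʳ (1- *-congˡ (*-congˡ (*-congʳ y≈ab)))))))))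
        third)
    rhs = *-cong π≈ (*-congʳ (*-cong
      (*-congˡ (1- trans (x^[1+n+n] N) (*-congˡ (*-cong y≈ab y≈ab))))
      (*-congˡ (1- trans (x^suc N) (*-congˡ y≈ab)))))

  telescope : ∀ N m → G N m + κ m * G N (suc (suc m)) ≈ π m * remainder N m
  telescope zero    m =
    solve 4 (λ a b c d → con (+ 0) :+ a :* con (+ 0) := b :* (c :* (con (+ 0) :* d))) refl _ _ _ _
  telescope (suc N) m = begin
    G N m + t m + κ m * (G N (suc (suc m)) + t (suc (suc m)))
      ≈⟨ solve 5 (λ a b c d e → a :+ b :+ c :* (d :+ e) := (a :+ c :* d) :+ (b :+ c :* e)) refl _ _ _ _ _ ⟩
    (G N m + κ m * G N (suc (suc m))) + (t m + κ m * t (suc (suc m)))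
      ≈⟨ +-congʳ (telescope N m) ⟩
    π m * remainder N m + (t m + κ m * t (suc (suc m)))
      ≈⟨ telescope-step N m ⟩
    π m * remainder (suc N) m ∎
    where
    t : ℕ → Carrier
    t m = x^ N * (c N * reciprocal N m)

  -- Limits within the given precision

  precision-mono : ∀ {m n} → precision ℕ.< 2 ℕ.* m → m ℕ.≤ n → precision ℕ.< 2 ℕ.* n
  precision-mono p m≤n = ℕ.<-≤-trans p (ℕ.*-monoʳ-≤ 2 m≤n)

  1-x^-small : ∀ n → precision ℕ.< 2 ℕ.* n → 1# - x^ n ≈ 1#
  1-x^-small n p = trans (1- q^-small p) (trans (+-congˡ -0#≈0#) (+-identityʳ 1#))

  -- Every further factor is 1 - x^i with 2i beyond the precision, hence equal to 1.
  v-stable : ∀ {n} k → precision ℕ.< 2 ℕ.* suc n → v (k ℕ.+ n) ≈ v n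
  v-stable         zero    p = refl
  v-stable {n} (suc k) p = trans (sym (trans (v-step (k ℕ.+ n))
    (trans (*-congʳ (1-x^-small (suc (k ℕ.+ n)) (precision-mono p (s≤s (ℕ.m≤n+m n k))))) (*-identityˡ _)))) (v-stable k p)

  ⟨x,x⟩-stable : ∀ {n} k → precision ℕ.< 2 ℕ.* suc n → ⟨x,x⟩ (k ℕ.+ n) ≈ ⟨x,x⟩ n
  ⟨x,x⟩-stable         zero    p = refl
  ⟨x,x⟩-stable {n} (suc k) p =
    trans (*-congˡ (1-x^-small (suc (k ℕ.+ n)) (precision-mono p (s≤s (ℕ.m≤n+m n k)))))
      (trans (*-identityʳ _) (⟨x,x⟩-stable k p))

  -- Large enough that N₀ - m - 1 still exceeds the precision for every m ≤ precision. It is also 2K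
  -- for K = precision + 1, the point where the iteration over even m stops.
  N₀ : ℕ
  N₀ = suc precision ℕ.+ suc precision

  -- In the limit `remainder` is (x;x²)_∞ (x;x)_∞ / (x;x)_∞², and (x;x²)_∞ (x²;x²)_∞ = (x;x)_∞
  -- cancels the rest.
  remainder-limit : ∀ m → 2 ℕ.* m ℕ.≤ precision → ⟨x²,x²⟩ N₀ * remainder N₀ m ≈ 1#
  remainder-limit m 2m≤p = begin
    ⟨x²,x²⟩ N₀ * (c N₀ * (D N₀ (suc m) * v (suc (N₀ ℕ.+ m))))
      ≈⟨ *-congˡ (*-congˡ (*-cong D≈v v≈v)) ⟩
    ⟨x²,x²⟩ N₀ * (⟨x,x²⟩ N₀ * ⟨x,x⟩ N₀ * (v N₀ * v N₀))
      ≈⟨ solve 4 (λ z a x v → z :* (a :* x :* (v :* v)) := (a :* z) :* v :* (x :* v)) refl _ _ _ _ ⟩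
    ⟨x,x²⟩ N₀ * ⟨x²,x²⟩ N₀ * v N₀ * (⟨x,x⟩ N₀ * v N₀)
      ≈⟨ *-cong (*-congʳ (trans (sym (⟨x,x⟩-double N₀)) (⟨x,x⟩-stable N₀ N₀-large))) (⟨x,x⟩-inverse N₀) ⟩
    ⟨x,x⟩ N₀ * v N₀ * 1#
      ≈⟨ trans (*-identityʳ _) (⟨x,x⟩-inverse N₀) ⟩
    1# ∎
    where
    m≤p : m ℕ.≤ precision
    m≤p = ℕ.≤-trans (ℕ.m≤n*m m 2) 2m≤p
    k : ℕ
    -- This is N₀ - m - 1, in a form that shows it to exceed the precision.
    k = suc precision ℕ.+ (precision ∸ m)
    N₀≡ : suc m ℕ.+ k ≡ N₀
    N₀≡ = ≡.trans (rearrange m precision (precision ∸ m))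
            (cong (λ t → suc precision ℕ.+ suc t) (ℕ.m+[n∸m]≡n m≤p))
      where
      rearrange : ∀ m p r → suc m ℕ.+ (suc p ℕ.+ r) ≡ suc p ℕ.+ suc (m ℕ.+ r)
      rearrange = solve-∀
    large : ∀ {n} → precision ℕ.≤ n → precision ℕ.< 2 ℕ.* suc n
    large p≤n = ℕ.≤-trans (s≤s p≤n) (ℕ.m≤n*m _ 2)
    N₀-large : precision ℕ.< 2 ℕ.* suc N₀
    N₀-large = large (ℕ.≤-trans (ℕ.n≤1+n _) (ℕ.m≤m+n (suc precision) _))
    k-large : precision ℕ.< 2 ℕ.* suc k
    k-large = large (ℕ.≤-trans (ℕ.n≤1+n _) (ℕ.m≤m+n (suc precision) _))
    D≈v : D N₀ (suc m) ≈ v N₀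
    D≈v = ≡.subst (λ n → D n (suc m) ≈ v n) N₀≡
      (trans (D-≥ (suc m) k) (sym (v-stable (suc m) k-large)))
    v≈v : v (suc (N₀ ℕ.+ m)) ≈ v N₀
    v≈v = trans (reflexive (cong v (cong suc (ℕ.+-comm N₀ m)))) (v-stable (suc m) N₀-large)

  -- For m too large for `remainder-limit`, x^m itself is 0; with the factor x^m the limit therefore
  -- holds for all m.
  x^m-remainder-limit : ∀ m → x^ m * (⟨x²,x²⟩ N₀ * remainder N₀ m) ≈ x^ m
  x^m-remainder-limit m with ℕ.≤-<-connex (2 ℕ.* m) precision
  ... | inj₁ 2m≤p = trans (*-congˡ (remainder-limit m 2m≤p)) (*-identityʳ _)
  ... | inj₂ p<2m = trans (*-congʳ (q^-small p<2m)) (trans (zeroˡ _) (sym (q^-small p<2m)))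

  -- Iteration over even m

  H : ℕ → Carrier
  H m = ⟨x²,x²⟩ N₀ * G N₀ m

  H-recurrence : ∀ m → H m ≈ π m - κ m * H (suc (suc m))
  H-recurrence m = begin
    P * g                           ≈⟨ solve 4 (λ P g k h → P :* g := P :* (g :+ k :* h) :- k :* (P :* h)) refl _ _ (κ m) (G N₀ (suc (suc m))) ⟩
    P * (g + κ m * h) - κ m * (P * h)
                                    ≈⟨ +-congʳ (*-congˡ (telescope N₀ m)) ⟩
    P * (x^ m * (1# + x^ (suc m)) * remainder N₀ m) - κ m * (P * h)
                                    ≈⟨ +-congʳ (solve 4 (λ P a b r → P :* (a :* b :* r) := a :* (P :* r) :* b) refl _ _ _ _) ⟩
    x^ m * (P * remainder N₀ m) * (1# + x^ (suc m)) - κ m * (P * h)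
                                    ≈⟨ +-congʳ (*-congʳ (x^m-remainder-limit m)) ⟩
    π m - κ m * (P * h)             ∎
    where
    P = ⟨x²,x²⟩ N₀
    g = G N₀ m
    h = G N₀ (suc (suc m))

  H-vanish : ∀ {m} → N₀ ℕ.≤ m → H m ≈ 0#
  H-vanish N₀≤m = trans (*-congˡ (∑-zero N₀ λ n n<N₀ →
    *-vanish _ _ _ (D-< (ℕ.<-≤-trans n<N₀ N₀≤m)))) (zeroʳ _)

  -- The coefficient that `H (2n)` has accumulated when the iteration reaches it: its own weight
  -- plus what the substitution for `H (2n-2)` passes on.
  B : ℕ → Carrier
  B zero    = weight 0
  B (suc n) = weight (suc n ℕ.+ suc n) - κ (n ℕ.+ n) * B n

  even-part-recurrence : ∀ K → ∑ (suc K) (λ k → weight (k ℕ.+ k) * H (k ℕ.+ k))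
    ≈ ∑ K (λ n → B n * π (n ℕ.+ n)) + B K * H (K ℕ.+ K)
  even-part-recurrence zero    = refl
  even-part-recurrence (suc K) = begin
    ∑ (suc K) (λ k → weight (k ℕ.+ k) * H (k ℕ.+ k)) + W * H (suc K ℕ.+ suc K)
      ≈⟨ +-congʳ (trans (even-part-recurrence K) (+-congˡ (*-congˡ (H-recurrence (K ℕ.+ K))))) ⟩
    s + B K * (π (K ℕ.+ K) - κ (K ℕ.+ K) * H (suc (suc (K ℕ.+ K)))) + W * H (suc K ℕ.+ suc K)
      ≡⟨ cong (λ i → s + B K * (π (K ℕ.+ K) - κ (K ℕ.+ K) * H i) + W * H (suc K ℕ.+ suc K)) (cong suc (ℕ.+-suc K K)) ⟨
    s + B K * (π (K ℕ.+ K) - κ (K ℕ.+ K) * H (suc K ℕ.+ suc K)) + W * H (suc K ℕ.+ suc K)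
      ≈⟨ solve 6 (λ s b p k h w → s :+ b :* (p :- k :* h) :+ w :* h := s :+ b :* p :+ (w :- k :* b) :* h) refl _ _ _ _ _ _ ⟩
    s + B K * π (K ℕ.+ K) + B (suc K) * H (suc K ℕ.+ suc K) ∎
    where
    W = weight (suc K ℕ.+ suc K)
    s = ∑ K (λ n → B n * π (n ℕ.+ n))

  -- After K = precision + 1 steps the leftover is a multiple of `H N₀`, which vanishes because each
  -- summand contains 1/(x;x)_{n-N₀} with n < N₀.
  even-part : ∑ (suc (suc precision)) (λ k → weight (k ℕ.+ k) * H (k ℕ.+ k))
    ≈ ∑ (suc precision) (λ n → B n * π (n ℕ.+ n))
  even-part = trans (even-part-recurrence (suc precision))
    (trans (+-congˡ (trans (*-congˡ (H-vanish ℕ.≤-refl)) (zeroʳ _))) (+-identityʳ _))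

  -- The Hecke-type double sum

  sign² : ∀ n → sign n * sign n ≈ 1#
  sign² zero    = *-identityʳ 1#
  sign² (suc n) = trans (solve 1 (λ s → :- s :* :- s := s :* s) refl _) (sign² n)

  sign-double : ∀ n → sign (n ℕ.+ n) ≈ 1#
  sign-double zero    = refl
  sign-double (suc n) rewrite ℕ.+-suc n n = trans (-‿involutive _) (sign-double n)

  -- The sum of f(|j|) over all integers j with |j| ≤ n.
  fold : ℕ → (ℕ → Carrier) → Carrier
  fold n f = f 0 + 2# * ∑ n (λ j → f (suc j))

  fold-*ˡ : ∀ n a f → a * fold n f ≈ fold n (λ j → a * f j)
  fold-*ˡ n a f = trans (solve 4 (λ a b c t → a :* (b :+ t :* c) := a :* b :+ t :* (a :* c)) refl _ _ _ _)
    (+-congˡ (*-congˡ (∑-*ˡ n a _)))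

  fold-cong : ∀ n {f g} → (∀ j → j ℕ.≤ n → f j ≈ g j) → fold n f ≈ fold n g
  fold-cong n f≈g = +-cong (f≈g 0 z≤n) (*-congˡ (∑-cong n λ j j<n → f≈g (suc j) j<n))

  2jj≤6nn : ∀ {j n} → j ℕ.≤ n → 2 ℕ.* j ℕ.* j ℕ.≤ 6 ℕ.* n ℕ.* n
  2jj≤6nn j≤n = ℕ.*-mono-≤ (ℕ.*-mono-≤ {2} {6} (s≤s (s≤s z≤n)) j≤n) j≤n

  q^-+-∸ : ∀ {e} a b s → s ℕ.≤ b → e ≡ a ℕ.+ b → q^ (e ∸ s) ≈ q^ a * q^ (b ∸ s)
  q^-+-∸ a b s s≤b ≡.refl = trans (reflexive (cong q^_ (ℕ.+-∸-assoc a s≤b))) (q^+ a (b ∸ s))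

  B-term : ℕ → ℕ → Carrier
  B-term n j = sign n * sign j * q^ (6 ℕ.* n ℕ.* n ∸ 2 ℕ.* j ℕ.* j)

  B-term-suc : ∀ {n j} → j ℕ.≤ n → B-term (suc n) j ≈ - κ (n ℕ.+ n) * B-term n j
  B-term-suc {n} {j} j≤n = begin
    - sign n * sign j * q^ (6 ℕ.* suc n ℕ.* suc n ∸ 2 ℕ.* j ℕ.* j)
      ≈⟨ *-congˡ (trans (q^-+-∸ _ _ (2 ℕ.* j ℕ.* j) (2jj≤6nn j≤n) (expand n)) (*-congʳ (trans (q^+ _ _) (*-congˡ (q^+ _ _))))) ⟩
    - sign n * sign j * (κ (n ℕ.+ n) * q^ (6 ℕ.* n ℕ.* n ∸ 2 ℕ.* j ℕ.* j))
      ≈⟨ solve 4 (λ s t k e → :- s :* t :* (k :* e) := :- k :* (s :* t :* e)) refl _ _ _ _ ⟩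
    - κ (n ℕ.+ n) * B-term n j ∎
    where
    -- 6(n+1)² - 6n² = 3(4n+2), the q-exponent of `κ (2n)`.
    expand : ∀ n → let y = 2 ℕ.* suc (n ℕ.+ n) in 6 ℕ.* suc n ℕ.* suc n ≡ y ℕ.+ (y ℕ.+ y) ℕ.+ 6 ℕ.* n ℕ.* n
    expand = solve-∀

  -- With k = n+1, q^{(2k)²} = q^{6k²-2k²}, and the signs (-1)^{2k} and ((-1)^k)² are both 1: the
  -- new weight is the pair j = ±k of the inner sum.
  weight-double : ∀ n → weight (suc n ℕ.+ suc n) ≈ 2# * B-term (suc n) (suc n)
  weight-double n = *-congˡ (*-cong (trans (sign-double (suc n)) (sym (sign² (suc n))))
    (reflexive (cong q^_ (≡.sym (≡.trans (cong (_∸ 2 ℕ.* suc n ℕ.* suc n) (expand (suc n))) (ℕ.m+n∸m≡n (2 ℕ.* suc n ℕ.* suc n) _))))))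
    where
    expand : ∀ k → 6 ℕ.* k ℕ.* k ≡ 2 ℕ.* k ℕ.* k ℕ.+ (k ℕ.+ k) ℕ.* (k ℕ.+ k)
    expand = solve-∀

  -- In the recurrence for `B`, multiplication by `- κ (2n)` carries the terms |j| ≤ n over to n+1,
  -- and the new weight supplies j = ±(n+1).
  B-closed-form : ∀ n → B n ≈ fold n (B-term n)
  B-closed-form zero    = sym (trans (+-cong (trans (*-cong (*-identityʳ 1#) q^0) (*-identityʳ 1#)) (zeroʳ _)) (+-identityʳ _))
  B-closed-form (suc n) = begin
    weight (suc n ℕ.+ suc n) - κ (n ℕ.+ n) * B n
      ≈⟨ +-cong (weight-double n) (trans (-‿distribˡ-* _ _) (trans (*-congˡ (B-closed-form n)) (fold-*ˡ n _ (B-term n)))) ⟩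
    2# * B-term (suc n) (suc n) + fold n (λ j → - κ (n ℕ.+ n) * B-term n j)
      ≈⟨ +-congˡ (fold-cong n λ j j≤n → B-term-suc j≤n) ⟨
    2# * B-term (suc n) (suc n) + fold n (B-term (suc n))
      ≈⟨ solve 4 (λ t a b c → t :* a :+ (b :+ t :* c) := b :+ t :* (c :+ a)) refl _ _ _ _ ⟩
    fold (suc n) (B-term (suc n)) ∎

  hecke-term : ℕ → ℕ → Carrier
  hecke-term n j = sign n * sign j * q^ (6 ℕ.* n ℕ.* n ℕ.+ 4 ℕ.* n ∸ 2 ℕ.* j ℕ.* j)

  hecke : ∀ n → B n * π (n ℕ.+ n) ≈ (1# + q^ (4 ℕ.* n ℕ.+ 2)) * fold n (hecke-term n)
  hecke n = begin
    B n * (x^ (n ℕ.+ n) * (1# + x^ (suc (n ℕ.+ n))))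
      ≈⟨ solve 3 (λ a b c → a :* (b :* c) := c :* (b :* a)) refl _ _ _ ⟩
    (1# + x^ (suc (n ℕ.+ n))) * (x^ (n ℕ.+ n) * B n)
      ≈⟨ *-cong (+-congˡ (reflexive (cong q^_ (expand₁ n)))) (trans (*-congˡ (B-closed-form n)) (fold-*ˡ n _ (B-term n))) ⟩
    (1# + q^ (4 ℕ.* n ℕ.+ 2)) * fold n (λ j → x^ (n ℕ.+ n) * B-term n j)
      ≈⟨ *-congˡ (fold-cong n λ j j≤n → trans
           (solve 3 (λ a b c → a :* (b :* c) := b :* (a :* c)) refl (x^ (n ℕ.+ n)) (sign n * sign j) (q^ (6 ℕ.* n ℕ.* n ∸ 2 ℕ.* j ℕ.* j)))
           (*-congˡ (sym (q^-+-∸ (2 ℕ.* (n ℕ.+ n)) (6 ℕ.* n ℕ.* n) (2 ℕ.* j ℕ.* j) (2jj≤6nn j≤n) (expand₂ n))))) ⟩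
    (1# + q^ (4 ℕ.* n ℕ.+ 2)) * fold n (hecke-term n) ∎
    where
    expand₁ : ∀ n → 2 ℕ.* suc (n ℕ.+ n) ≡ 4 ℕ.* n ℕ.+ 2
    expand₁ = solve-∀
    expand₂ : ∀ n → 6 ℕ.* n ℕ.* n ℕ.+ 4 ℕ.* n ≡ 2 ℕ.* (n ℕ.+ n) ℕ.+ 6 ℕ.* n ℕ.* n
    expand₂ = solve-∀

  -- Parity

  σ-0 : σ 0# ≈ 0#
  σ-0 = +-identityˡ-unique _ _ (trans (sym (σ-+ 0# 0#)) (σ-cong (+-identityʳ 0#)))

  σ-neg : ∀ f → σ (- f) ≈ - σ f
  σ-neg f = +-inverseˡ-unique _ _ (trans (sym (σ-+ _ _)) (trans (σ-cong (-‿inverseˡ f)) σ-0))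

  Even Odd : Carrier → Set
  Even f = σ f ≈ f
  Odd  f = σ f ≈ - f

  +-even : ∀ {f g} → Even f → Even g → Even (f + g)
  +-even ef eg = trans (σ-+ _ _) (+-cong ef eg)

  *-even : ∀ {f g} → Even f → Even g → Even (f * g)
  *-even ef eg = trans (σ-* _ _) (*-cong ef eg)

  neg-even : ∀ {f} → Even f → Even (- f)
  neg-even ef = trans (σ-neg _) (-‿cong ef)

  *-odd-even : ∀ {f g} → Odd f → Even g → Odd (f * g)
  *-odd-even of eg = trans (σ-* _ _) (trans (*-cong of eg) (sym (-‿distribˡ-* _ _)))

  *-even-odd : ∀ {f g} → Even f → Odd g → Odd (f * g)
  *-even-odd ef og = trans (σ-* _ _) (trans (*-cong ef og) (sym (-‿distribʳ-* _ _)))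

  q²-even : Even (q * q)
  q²-even = trans (σ-* q q) (trans (*-cong σ-q σ-q) (solve 1 (λ s → :- s :* :- s := s :* s) refl _))

  x^-even : ∀ n → Even (x^ n)
  x^-even zero    = trans (σ-cong q^0) (trans σ-1 (sym q^0))
  x^-even (suc n) = trans (σ-cong (x^suc n)) (trans (*-even q²-even (x^-even n)) (sym (x^suc n)))

  ∑-even : ∀ n {f} → (∀ i → Even (f i)) → Even (∑ n f)
  ∑-even zero    ef = σ-0
  ∑-even (suc n) ef = +-even (∑-even n ef) (ef n)

  ∑-odd : ∀ n {f} → (∀ i → Odd (f i)) → Odd (∑ n f)
  ∑-odd zero    of = trans σ-0 (sym -0#≈0#)
  ∑-odd (suc n) of = trans (σ-+ _ _) (trans (+-cong (∑-odd n of) (of n)) (-‿+-comm _ _))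

  ∏-even : ∀ n {f} → (∀ i → Even (f i)) → Even (∏ n f)
  ∏-even zero    ef = σ-1
  ∏-even (suc n) ef = *-even (∏-even n ef) (ef n)

  1-x^-even : ∀ n → Even (1# - x^ n)
  1-x^-even n = +-even σ-1 (neg-even (x^-even n))

  -- Inverses are unique: σ fixes (x;x)_n, so `σ (v n)` inverts it as well.
  v-even : ∀ n → Even (v n)
  v-even n = begin
    σ (v n)                   ≈⟨ *-identityʳ _ ⟨
    σ (v n) * 1#              ≈⟨ *-congˡ (⟨x,x⟩-inverse n) ⟨
    σ (v n) * (⟨x,x⟩ n * v n) ≈⟨ solve 3 (λ a b c → a :* (b :* c) := b :* a :* c) refl _ _ _ ⟩
    ⟨x,x⟩ n * σ (v n) * v n   ≈⟨ *-congʳ (*-congʳ (∏-even n λ j → 1-x^-even (suc j))) ⟨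
    σ (⟨x,x⟩ n) * σ (v n) * v n ≈⟨ *-congʳ (trans (sym (σ-* _ _)) (trans (σ-cong (⟨x,x⟩-inverse n)) σ-1)) ⟩
    1# * v n                  ≈⟨ *-identityˡ _ ⟩
    v n                       ∎

  D-even : ∀ n m → Even (D n m)
  D-even n       zero    = v-even n
  D-even zero    (suc m) = σ-0
  D-even (suc n) (suc m) = D-even n m

  H-even : ∀ m → Even (H m)
  H-even m = *-even (∏-even N₀ λ j → 1-x^-even (suc j ℕ.+ suc j)) (∑-even N₀ λ n →
    *-even (x^-even n) (*-even (*-even (∏-even n λ j → 1-x^-even (suc (j ℕ.+ j))) (∏-even n λ j → 1-x^-even (suc j)))
                               (*-even (D-even n m) (v-even (n ℕ.+ m)))))

  sign-even : ∀ n → Even (sign n)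
  sign-even zero    = σ-1
  sign-even (suc n) = neg-even (sign-even n)

  2-even : Even 2#
  2-even = +-even σ-1 σ-1

  weight-even : ∀ k → Even (weight (k ℕ.+ k))
  weight-even zero    = σ-1
  weight-even (suc k) = *-even 2-even (*-even (sign-even (suc k ℕ.+ suc k))
    (trans (σ-cong square) (trans (x^-even (2 ℕ.* suc k ℕ.* suc k)) (sym square))))
    where
    square : q^ ((suc k ℕ.+ suc k) ℕ.* (suc k ℕ.+ suc k)) ≈ x^ (2 ℕ.* suc k ℕ.* suc k)
    square = reflexive (cong q^_ (expand (suc k)))
      where
      expand : ∀ n → (n ℕ.+ n) ℕ.* (n ℕ.+ n) ≡ 2 ℕ.* (2 ℕ.* n ℕ.* n)
      expand = solve-∀

  weight-odd : ∀ k → Odd (weight (suc (k ℕ.+ k)))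
  weight-odd k = *-even-odd 2-even (*-even-odd (sign-even (suc (k ℕ.+ k)))
    (trans (σ-cong square) (trans (*-odd-even σ-q (x^-even (2 ℕ.* (k ℕ.* k ℕ.+ k)))) (-‿cong (sym square)))))
    where
    square : q^ (suc (k ℕ.+ k) ℕ.* suc (k ℕ.+ k)) ≈ q * x^ (2 ℕ.* (k ℕ.* k ℕ.+ k))
    square = trans (reflexive (cong q^_ (expand k))) (q^+ 1 _)
      where
      expand : ∀ n → suc (n ℕ.+ n) ℕ.* suc (n ℕ.+ n) ≡ 1 ℕ.+ 2 ℕ.* (2 ℕ.* (n ℕ.* n ℕ.+ n))
      expand = solve-∀

  -- Everything except the weights is a series in x, so the parity of j is the parity of its term.
  -- Evenness of the double sum is inherited from the sum over even j, to which it is equal.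
  parity-decomposition : ∃ λ odd → Odd odd ×
    Even (∑ (suc precision) (λ n → (1# + q^ (4 ℕ.* n ℕ.+ 2)) * fold n (hecke-term n))) ×
    ⟨x²,x²⟩ N₀ * ∑ N₀ S-summand ≈ ∑ (suc precision) (λ n → (1# + q^ (4 ℕ.* n ℕ.+ 2)) * fold n (hecke-term n)) + odd
  parity-decomposition = O , O-odd , trans (σ-cong (sym E≈)) (trans E-even E≈) , (begin
    P * ∑ N₀ S-summand
      -- The cut-off gives the range j < 2L with L = precision + 2; its even half is the range of
      -- `even-part`.
      ≈⟨ *-congˡ (S-expansion N₀ (suc precision ℕ.+ L) (ℕ.+-mono-≤ (ℕ.n≤1+n (suc precision)) (ℕ.n≤1+n (suc precision)))) ⟩
    P * ∑ (L ℕ.+ L) (λ j → weight j * G N₀ j)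
      ≈⟨ trans (∑-*ˡ (L ℕ.+ L) _ _) (∑-cong (L ℕ.+ L) λ j _ → solve 3 (λ a b c → a :* (b :* c) := b :* (a :* c)) refl _ _ _) ⟩
    ∑ (L ℕ.+ L) (λ j → weight j * H j)
      ≈⟨ ∑-even-odd L _ ⟩
    E + O
      ≈⟨ +-congʳ E≈ ⟩
    ∑ (suc precision) (λ n → (1# + q^ (4 ℕ.* n ℕ.+ 2)) * fold n (hecke-term n)) + O ∎)
    where
    P = ⟨x²,x²⟩ N₀
    L = suc (suc precision)
    E = ∑ L (λ k → weight (k ℕ.+ k) * H (k ℕ.+ k))
    O = ∑ L (λ k → weight (suc (k ℕ.+ k)) * H (suc (k ℕ.+ k)))
    E-even : Even E
    E-even = ∑-even L λ k → *-even (weight-even k) (H-even (k ℕ.+ k))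
    O-odd : Odd O
    O-odd = ∑-odd L λ k → *-odd-even (weight-odd k) (H-even (suc (k ℕ.+ k)))
    E≈ : E ≈ ∑ (suc precision) (λ n → (1# + q^ (4 ℕ.* n ℕ.+ 2)) * fold n (hecke-term n))
    E≈ = trans even-part (∑-cong (suc precision) λ n _ → hecke n)

  -- Induction strips both ends of the range, k = 0 and k = 2n+2, which each contribute g(n+1).
  ∑-symmetric : ∀ n g → ∑ (suc (n ℕ.+ n)) (λ k → g ℕ.∣ k - n ∣) ≈ fold n g
  ∑-symmetric zero    g = trans (+-identityˡ _) (sym (trans (+-congˡ (zeroʳ _)) (+-identityʳ _)))
  ∑-symmetric (suc n) g rewrite ℕ.+-suc n n = begin
    ∑ (suc (suc (n ℕ.+ n))) (λ k → g ℕ.∣ k - suc n ∣) + g ℕ.∣ suc (n ℕ.+ n) - n ∣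
      ≈⟨ +-cong (∑-head (suc (n ℕ.+ n)) _) (reflexive (cong g last)) ⟩
    g (suc n) + ∑ (suc (n ℕ.+ n)) (λ k → g ℕ.∣ k - n ∣) + g (suc n)
      ≈⟨ +-congʳ (+-congˡ (∑-symmetric n g)) ⟩
    g (suc n) + fold n g + g (suc n)
      ≈⟨ solve 3 (λ a b c → a :+ (b :+ (con (+ 1) :+ con (+ 1)) :* c) :+ a := b :+ (con (+ 1) :+ con (+ 1)) :* (c :+ a)) refl _ _ _ ⟩
    fold (suc n) g ∎
    where
    last : ℕ.∣ suc (n ℕ.+ n) - n ∣ ≡ suc n
    last = ≡.trans (cong ℕ.∣_- n ∣ (≡.sym (ℕ.+-suc n n))) (≡.trans (ℕ.∣-∣-comm (n ℕ.+ suc n) n) (ℕ.∣m-m+n∣≡n n (suc n)))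

-- Formal power series

open ≡ using (_≢_; _≗_; refl; cong₂)
open ≡.≡-Reasoning

sumTo-cong : ∀ n {f g} → (∀ i → i ℕ.≤ n → f i ≡ g i) → sumTo f n ≡ sumTo g n
sumTo-cong zero    f≡g = f≡g 0 z≤n
sumTo-cong (suc n) f≡g =
  cong₂ ℤ._+_ (sumTo-cong n λ i i≤n → f≡g i (ℕ.m≤n⇒m≤1+n i≤n)) (f≡g (suc n) ℕ.≤-refl)

sumTo-head : ∀ n f → sumTo f (suc n) ≡ f 0 ℤ.+ sumTo (f ∘ suc) n
sumTo-head zero    f = refl
sumTo-head (suc n) f = ≡.trans (cong (ℤ._+ f (suc (suc n))) (sumTo-head n f)) (ℤ.+-assoc (f 0) _ _)

sumTo-zero : ∀ n → sumTo (λ _ → + 0) n ≡ + 0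
sumTo-zero zero    = refl
sumTo-zero (suc n) = cong (ℤ._+ + 0) (sumTo-zero n)

sumTo-+ : ∀ n f g → sumTo (λ i → f i ℤ.+ g i) n ≡ sumTo f n ℤ.+ sumTo g n
sumTo-+ zero    f g = refl
sumTo-+ (suc n) f g = ≡.trans (cong (ℤ._+ (f (suc n) ℤ.+ g (suc n))) (sumTo-+ n f g))
  (interchange (sumTo f n) (sumTo g n) (f (suc n)) (g (suc n)))
  where
  interchange : ∀ a b c d → (a ℤ.+ b) ℤ.+ (c ℤ.+ d) ≡ (a ℤ.+ c) ℤ.+ (b ℤ.+ d)
  interchange = ℤSolver.solve-∀

sumTo-*ˡ : ∀ n a f → sumTo (λ i → a ℤ.* f i) n ≡ a ℤ.* sumTo f n
sumTo-*ˡ zero    a f = refl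
sumTo-*ˡ (suc n) a f =
  ≡.trans (cong (ℤ._+ a ℤ.* f (suc n)) (sumTo-*ˡ n a f)) (≡.sym (ℤ.*-distribˡ-+ a _ _))

sumTo-extend : ∀ k n f → (∀ i → n ℕ.< i → f i ≡ + 0) → sumTo f (k ℕ.+ n) ≡ sumTo f n
sumTo-extend zero    n f f≡0 = refl
sumTo-extend (suc k) n f f≡0 =
  ≡.trans (cong₂ ℤ._+_ (sumTo-extend k n f f≡0) (f≡0 _ (s≤s (ℕ.m≤n+m n k)))) (ℤ.+-identityʳ _)

⊝_ : PS → PS
(⊝ f) n = ℤ.- f n

zeroPS : PS
zeroPS _ = + 0

⊗-head : ∀ f g n → (f ⊗ g) (suc n) ≡ f 0 ℤ.* g (suc n) ℤ.+ ((f ∘ suc) ⊗ g) n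
⊗-head f g n = sumTo-head n _

⊗-last : ∀ f g n → (f ⊗ g) (suc n) ≡ (f ⊗ (g ∘ suc)) n ℤ.+ f (suc n) ℤ.* g 0
⊗-last f g n = cong₂ ℤ._+_
  (sumTo-cong n λ i i≤n → cong (λ t → f i ℤ.* g t) (ℕ.+-∸-assoc 1 i≤n))
  (cong (λ t → f (suc n) ℤ.* g t) (ℕ.n∸n≡0 n))

-- Splitting off the first summand on one side and the last on the other leaves products of lower
-- degree with one factor shifted.
⊗-comm : ∀ f g → f ⊗ g ≗ g ⊗ f
⊗-comm f g zero    = ℤ.*-comm (f 0) (g 0)
⊗-comm f g (suc n) = begin
  (f ⊗ g) (suc n)                              ≡⟨ ⊗-head f g n ⟩
  f 0 ℤ.* g (suc n) ℤ.+ ((f ∘ suc) ⊗ g) n      ≡⟨ cong₂ ℤ._+_ (ℤ.*-comm (f 0) _) (⊗-comm (f ∘ suc) g n) ⟩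
  g (suc n) ℤ.* f 0 ℤ.+ (g ⊗ (f ∘ suc)) n      ≡⟨ ℤ.+-comm (g (suc n) ℤ.* f 0) _ ⟩
  (g ⊗ (f ∘ suc)) n ℤ.+ g (suc n) ℤ.* f 0      ≡⟨ ⊗-last g f n ⟨
  (g ⊗ f) (suc n)                              ∎

⊗-cong-≤ : ∀ n {f f′ g g′} → (∀ i → i ℕ.≤ n → f i ≡ f′ i) → (∀ i → i ℕ.≤ n → g i ≡ g′ i) →
  (f ⊗ g) n ≡ (f′ ⊗ g′) n
⊗-cong-≤ n f≡ g≡ = sumTo-cong n λ i i≤n → cong₂ ℤ._*_ (f≡ i i≤n) (g≡ (n ∸ i) (ℕ.m∸n≤m n i))

⊗-congˡ : ∀ {f f′} g → f ≗ f′ → f ⊗ g ≗ f′ ⊗ g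
⊗-congˡ g f≗f′ n = ⊗-cong-≤ n {g = g} (λ i _ → f≗f′ i) (λ _ _ → refl)

⊗-distribʳ : ∀ f g h → (g ⊕ h) ⊗ f ≗ g ⊗ f ⊕ h ⊗ f
⊗-distribʳ f g h n = ≡.trans
  (sumTo-cong n λ i _ → ℤ.*-distribʳ-+ (f (n ∸ i)) (g i) (h i)) (sumTo-+ n _ _)

⊗-scaleˡ : ∀ a f g → (λ k → a ℤ.* f k) ⊗ g ≗ λ n → a ℤ.* (f ⊗ g) n
⊗-scaleˡ a f g n = ≡.trans (sumTo-cong n λ i _ → ℤ.*-assoc a (f i) _) (sumTo-*ˡ n a _)

⊗-zeroˡ : ∀ f → zeroPS ⊗ f ≗ zeroPS
⊗-zeroˡ f n = ≡.trans (sumTo-cong n λ i _ → ℤ.*-zeroˡ (f (n ∸ i))) (sumTo-zero n)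

⊗-assoc : ∀ f g h → (f ⊗ g) ⊗ h ≗ f ⊗ (g ⊗ h)
⊗-assoc f g h zero    = ℤ.*-assoc (f 0) (g 0) (h 0)
⊗-assoc f g h (suc n) = begin
  ((f ⊗ g) ⊗ h) (suc n)
    ≡⟨ ⊗-head (f ⊗ g) h n ⟩
  f 0 ℤ.* g 0 ℤ.* h (suc n) ℤ.+ (((f ⊗ g) ∘ suc) ⊗ h) n
    ≡⟨ cong (λ t → f 0 ℤ.* g 0 ℤ.* h (suc n) ℤ.+ t) (begin
       (((f ⊗ g) ∘ suc) ⊗ h) n                              ≡⟨ ⊗-congˡ h (⊗-head f g) n ⟩
       (((λ k → f 0 ℤ.* g (suc k)) ⊕ (f ∘ suc) ⊗ g) ⊗ h) n  ≡⟨ ⊗-distribʳ h (λ k → f 0 ℤ.* g (suc k)) ((f ∘ suc) ⊗ g) n ⟩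
       ((λ k → f 0 ℤ.* g (suc k)) ⊗ h) n ℤ.+ (((f ∘ suc) ⊗ g) ⊗ h) n
                                                            ≡⟨ cong₂ ℤ._+_ (⊗-scaleˡ (f 0) (g ∘ suc) h n) (⊗-assoc (f ∘ suc) g h n) ⟩
       f 0 ℤ.* ((g ∘ suc) ⊗ h) n ℤ.+ ((f ∘ suc) ⊗ (g ⊗ h)) n ∎) ⟩
  f 0 ℤ.* g 0 ℤ.* h (suc n) ℤ.+ (f 0 ℤ.* ((g ∘ suc) ⊗ h) n ℤ.+ ((f ∘ suc) ⊗ (g ⊗ h)) n)
    ≡⟨ regroup (f 0) (g 0) (h (suc n)) (((g ∘ suc) ⊗ h) n) (((f ∘ suc) ⊗ (g ⊗ h)) n) ⟩
  f 0 ℤ.* (g 0 ℤ.* h (suc n) ℤ.+ ((g ∘ suc) ⊗ h) n) ℤ.+ ((f ∘ suc) ⊗ (g ⊗ h)) n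
    ≡⟨ cong (λ t → f 0 ℤ.* t ℤ.+ ((f ∘ suc) ⊗ (g ⊗ h)) n) (⊗-head g h n) ⟨
  f 0 ℤ.* (g ⊗ h) (suc n) ℤ.+ ((f ∘ suc) ⊗ (g ⊗ h)) n
    ≡⟨ ⊗-head f (g ⊗ h) n ⟨
  (f ⊗ (g ⊗ h)) (suc n) ∎
  where
  regroup : ∀ a b c d e → a ℤ.* b ℤ.* c ℤ.+ (a ℤ.* d ℤ.+ e) ≡ a ℤ.* (b ℤ.* c ℤ.+ d) ℤ.+ e
  regroup = ℤSolver.solve-∀

⊗-identityˡ : ∀ f → one ⊗ f ≗ f
⊗-identityˡ f zero    = ℤ.*-identityˡ (f 0)
⊗-identityˡ f (suc n) = ≡.trans (⊗-head one f n)
  (≡.trans (cong₂ ℤ._+_ (ℤ.*-identityˡ (f (suc n))) (⊗-zeroˡ f n)) (ℤ.+-identityʳ _))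

-- Monomials

mono-suc : ∀ c e n → mono c (suc e) (suc n) ≡ mono c e n
mono-suc c e n with suc n ℕ.≟ suc e | n ℕ.≟ e
... | yes _    | yes _   = refl
... | no _     | no _    = refl
... | yes refl | no n≢e  = ⊥-elim (n≢e refl)
... | no n≢e   | yes refl = ⊥-elim (n≢e refl)

mono-< : ∀ c {e n} → n ℕ.< e → mono c e n ≡ + 0
mono-< c {e} {n} n<e with n ℕ.≟ e
... | yes n≡e = ⊥-elim (ℕ.<⇒≢ n<e n≡e)
... | no  _   = refl

mono-zero : mono (+ 1) 0 ≗ one
mono-zero zero    = refl
mono-zero (suc n) = refl

mono-neg : ∀ c e n → mono (ℤ.- c) e n ≡ ℤ.- mono c e n
mono-neg c e n with n ℕ.≟ e
... | yes _ = refl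
... | no  _ = refl

mono-⊗ : ∀ c d a b → mono c a ⊗ mono d b ≗ mono (c ℤ.* d) (a ℕ.+ b)
mono-⊗ c d zero zero zero = refl
mono-⊗ c d zero (suc b) zero = ℤ.*-zeroʳ c
mono-⊗ c d zero b (suc n) = ≡.trans (⊗-head (mono c 0) (mono d b) n)
  (≡.trans (cong (λ t → c ℤ.* mono d b (suc n) ℤ.+ t) (⊗-zeroˡ (mono d b) n)) (≡.trans (ℤ.+-identityʳ _) scale))
  where
  scale : c ℤ.* mono d b (suc n) ≡ mono (c ℤ.* d) b (suc n)
  scale with suc n ℕ.≟ b
  ... | yes _ = refl
  ... | no  _ = ℤ.*-zeroʳ c
mono-⊗ c d (suc a) b zero = ℤ.*-zeroˡ (mono d b 0)
mono-⊗ c d (suc a) b (suc n) = begin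
  (mono c (suc a) ⊗ mono d b) (suc n)                             ≡⟨ ⊗-head (mono c (suc a)) (mono d b) n ⟩
  + 0 ℤ.* mono d b (suc n) ℤ.+ ((mono c (suc a) ∘ suc) ⊗ mono d b) n ≡⟨ cong₂ ℤ._+_ (ℤ.*-zeroˡ (mono d b (suc n))) (⊗-congˡ (mono d b) (mono-suc c a) n) ⟩
  + 0 ℤ.+ (mono c a ⊗ mono d b) n                                 ≡⟨ ℤ.+-identityˡ _ ⟩
  (mono c a ⊗ mono d b) n                                         ≡⟨ mono-⊗ c d a b n ⟩
  mono (c ℤ.* d) (a ℕ.+ b) n                                      ≡⟨ mono-suc (c ℤ.* d) (a ℕ.+ b) n ⟨
  mono (c ℤ.* d) (suc a ℕ.+ b) (suc n)                            ∎

-- A copy of the private helper in the definition of invList, which cannot be named here.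
weighted : PS → ℕ → List ℤ → ℤ
weighted f i []       = + 0
weighted f i (x ∷ xs) = f (suc i) ℤ.* x ℤ.+ weighted f (suc i) xs

-- `invList` stores the coefficients from the n-th downwards, so pairing them with increasing
-- coefficients of f is a Cauchy product; the offset i is general for the induction.
weighted-invList : ∀ f n i → weighted f i (invList f n) ≡ ((λ k → f (suc (i ℕ.+ k))) ⊗ inv f) n
weighted-invList f zero    i = ≡.trans (ℤ.+-identityʳ _) (cong (λ t → f (suc t) ℤ.* + 1) (≡.sym (ℕ.+-identityʳ i)))
weighted-invList f (suc n) i = ≡.trans
  (cong₂ ℤ._+_ (cong (λ t → f (suc t) ℤ.* inv f (suc n)) (≡.sym (ℕ.+-identityʳ i)))
    (≡.trans (weighted-invList f n (suc i)) (⊗-congˡ (inv f) (λ k → cong (f ∘ suc) (≡.sym (ℕ.+-suc i k))) n)))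
  (≡.sym (⊗-head (λ k → f (suc (i ℕ.+ k))) (inv f) n))

-- The underscore stands for the private helper; it is inferred from the call in inv-suc,
-- where the with-abstraction exposes it as a function of i and xs.
mutual
  weighted-unique : ∀ f i xs → _ ≡ weighted f i xs
  weighted-unique f i []       = refl
  weighted-unique f i (x ∷ xs) = cong (λ t → f (suc i) ℤ.* x ℤ.+ t) (weighted-unique f (suc i) xs)

  inv-suc : ∀ f n → inv f (suc n) ≡ ℤ.- weighted f 0 (invList f n)
  inv-suc f n with 0 | invList f n
  ... | i | xs = cong ℤ.-_ (weighted-unique f i xs)

⊗-inverseʳ : ∀ f → f 0 ≡ + 1 → f ⊗ inv f ≗ one
⊗-inverseʳ f f₀≡1 zero    = ≡.trans (ℤ.*-identityʳ (f 0)) f₀≡1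
⊗-inverseʳ f f₀≡1 (suc n) = begin
  (f ⊗ inv f) (suc n)
    ≡⟨ ⊗-head f (inv f) n ⟩
  f 0 ℤ.* inv f (suc n) ℤ.+ ((f ∘ suc) ⊗ inv f) n
    ≡⟨ cong (ℤ._+ ((f ∘ suc) ⊗ inv f) n) (cong₂ ℤ._*_ f₀≡1
         (≡.trans (inv-suc f n) (cong ℤ.-_ (weighted-invList f n 0)))) ⟩
  + 1 ℤ.* ℤ.- ((f ∘ suc) ⊗ inv f) n ℤ.+ ((f ∘ suc) ⊗ inv f) n
    ≡⟨ cong (ℤ._+ ((f ∘ suc) ⊗ inv f) n) (ℤ.*-identityˡ (ℤ.- ((f ∘ suc) ⊗ inv f) n)) ⟩
  ℤ.- ((f ∘ suc) ⊗ inv f) n ℤ.+ ((f ∘ suc) ⊗ inv f) n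
    ≡⟨ ℤ.+-inverseˡ (((f ∘ suc) ⊗ inv f) n) ⟩
  + 0 ∎

-- The substitution q ↦ -q

sgn-+ : ∀ m n → sgn (m ℕ.+ n) ≡ sgn m ℤ.* sgn n
sgn-+ zero    n = ≡.sym (ℤ.*-identityˡ _)
sgn-+ (suc m) n = ≡.trans (cong ℤ.-_ (sgn-+ m n)) (ℤ.neg-distribˡ-* (sgn m) (sgn n))

alternate : PS → PS
alternate f n = sgn n ℤ.* f n

alternate-⊗ : ∀ f g → alternate (f ⊗ g) ≗ alternate f ⊗ alternate g
alternate-⊗ f g n = ≡.trans (≡.sym (sumTo-*ˡ n (sgn n) _)) (sumTo-cong n λ i i≤n → begin
  sgn n ℤ.* (f i ℤ.* g (n ∸ i))
    ≡⟨ cong (λ t → sgn t ℤ.* (f i ℤ.* g (n ∸ i))) (ℕ.m+[n∸m]≡n i≤n) ⟨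
  sgn (i ℕ.+ (n ∸ i)) ℤ.* (f i ℤ.* g (n ∸ i))
    ≡⟨ cong (ℤ._* (f i ℤ.* g (n ∸ i))) (sgn-+ i (n ∸ i)) ⟩
  sgn i ℤ.* sgn (n ∸ i) ℤ.* (f i ℤ.* g (n ∸ i))
    ≡⟨ interchange (sgn i) (sgn (n ∸ i)) (f i) (g (n ∸ i)) ⟩
  sgn i ℤ.* f i ℤ.* (sgn (n ∸ i) ℤ.* g (n ∸ i)) ∎)
  where
  interchange : ∀ a b c d → a ℤ.* b ℤ.* (c ℤ.* d) ≡ a ℤ.* c ℤ.* (b ℤ.* d)
  interchange = ℤSolver.solve-∀

-- Power series modulo q^{M+1}

infix 4 _≈[_]_

record _≈[_]_ (f : PS) (M : ℕ) (g : PS) : Set where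
  constructor agree
  field
    at : ∀ i → i ℕ.≤ M → f i ≡ g i

open _≈[_]_

everywhere : ∀ {M f g} → f ≗ g → f ≈[ M ] g
everywhere f≗g = agree λ i _ → f≗g i

-- Coefficient i of a product involves only coefficients up to i, so multiplication respects
-- agreement up to M.
truncatedRing : ℕ → CommutativeRing 0ℓ 0ℓ
truncatedRing M = record
  { Carrier = PS
  ; _≈_ = _≈[ M ]_
  ; _+_ = _⊕_
  ; _*_ = _⊗_
  ; -_  = ⊝_
  ; 0#  = zeroPS
  ; 1#  = one
  ; isCommutativeRing = record
    { isRing = record
      { +-isAbelianGroup = record
        { isGroup = record
          { isMonoid = record
            { isSemigroup = record
              { isMagma = record
                { isEquivalence = record
                  { refl  = everywhere λ _ → refl
                  ; sym   = λ p → agree λ i i≤M → ≡.sym (at p i i≤M)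
                  ; trans = λ p r → agree λ i i≤M → ≡.trans (at p i i≤M) (at r i i≤M)
                  }
                ; ∙-cong = λ p r → agree λ i i≤M → cong₂ ℤ._+_ (at p i i≤M) (at r i i≤M)
                }
              ; assoc = λ f g h → everywhere λ i → ℤ.+-assoc (f i) (g i) (h i)
              }
            ; identity = (λ f → everywhere λ i → ℤ.+-identityˡ (f i)) , λ f → everywhere λ i → ℤ.+-identityʳ (f i)
            }
          ; inverse = (λ f → everywhere λ i → ℤ.+-inverseˡ (f i)) , λ f → everywhere λ i → ℤ.+-inverseʳ (f i)
          ; ⁻¹-cong = λ p → agree λ i i≤M → cong ℤ.-_ (at p i i≤M)
          }
        ; comm = λ f g → everywhere λ i → ℤ.+-comm (f i) (g i)
        }
      ; *-cong = λ p r → agree λ i i≤M → ⊗-cong-≤ i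
          (λ j j≤i → at p j (ℕ.≤-trans j≤i i≤M)) (λ j j≤i → at r j (ℕ.≤-trans j≤i i≤M))
      ; *-assoc = λ f g h → everywhere (⊗-assoc f g h)
      ; *-identity = (λ f → everywhere (⊗-identityˡ f)) ,
          λ f → everywhere λ i → ≡.trans (⊗-comm f one i) (⊗-identityˡ f i)
      ; distrib = (λ f g h → everywhere λ i → ≡.trans (⊗-comm f (g ⊕ h) i)
          (≡.trans (⊗-distribʳ f g h i) (cong₂ ℤ._+_ (⊗-comm g f i) (⊗-comm h f i))))
        , λ f g h → everywhere (⊗-distribʳ f g h)
      }
    ; *-comm = λ f g → everywhere (⊗-comm f g)
    }
  }

prodPS-constant : ∀ {F} n → (∀ j → F j 0 ≡ + 1) → prodPS F n 0 ≡ + 1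
prodPS-constant zero    F₀≡1 = refl
prodPS-constant (suc n) F₀≡1 = cong₂ ℤ._*_ (prodPS-constant n F₀≡1) (F₀≡1 n)

module Products (M : ℕ) where
  open CommutativeRing (truncatedRing M) using (_≈_; *-cong) renaming (refl to ≈-refl)
  open Sums (truncatedRing M)

  prodPS-∏ : ∀ n {F G} → (∀ j → F j ≈ G j) → prodPS F n ≈ ∏ n G
  prodPS-∏ zero    F≈G = ≈-refl
  prodPS-∏ (suc n) F≈G = *-cong (prodPS-∏ n F≈G) (F≈G n)

  ∏-constant : ∀ {F} n → (∀ j → F j 0 ≡ + 1) → ∏ n F 0 ≡ + 1
  ∏-constant zero    F₀≡1 = refl
  ∏-constant (suc n) F₀≡1 = cong₂ ℤ._*_ (∏-constant n F₀≡1) (F₀≡1 n)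

  factor-neg : ∀ {a b} → a ≡ b → one ⊖ mono (ℤ.- (+ 1)) a ≈ one ⊕ mono (+ 1) b
  factor-neg {a} refl = everywhere λ i → cong (λ t → one i ℤ.+ t)
    (≡.trans (cong ℤ.-_ (mono-neg (+ 1) a i)) (ℤ.neg-involutive (mono (+ 1) a i)))

  poch-⟨-x,x⟩ : ∀ n → poch (ℤ.- (+ 1)) 2 2 n ≈ ∏ n λ j → one ⊕ mono (+ 1) (2 ℕ.* suc j)
  poch-⟨-x,x⟩ n = prodPS-∏ n λ j → factor-neg (≡.sym (ℕ.*-suc 2 j))

seriesRing : ℕ → SeriesRing
seriesRing M = record
  { commutativeRing = truncatedRing M
  ; q^_ = mono (+ 1)
  ; q^0 = everywhere mono-zero
  ; q^+ = λ a b → everywhere λ i → ≡.sym (mono-⊗ (+ 1) (+ 1) a b i)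
  ; precision = M
  ; q^-small = λ M<e → agree λ i i≤M → mono-< (+ 1) (ℕ.≤-<-trans i≤M M<e)
  ; 1/⟨x,x⟩ = λ n → inv (∏ n λ j → one ⊖ mono (+ 1) (2 ℕ.* suc j))
  -- The inverse is that of the very product in the definition of `S`, so this factor of the summand
  -- matches as it stands.
  ; 1/⟨-x,x⟩ = λ n → inv (poch (ℤ.- (+ 1)) 2 2 n)
  ; ⟨x,x⟩-inverse = λ n → everywhere (⊗-inverseʳ (∏ n λ j → one ⊖ mono (+ 1) (2 ℕ.* suc j)) (∏-constant n λ j → refl))
  ; ⟨-x,x⟩-inverse = λ n → ≈.trans (≈.*-congʳ {inv (poch (ℤ.- (+ 1)) 2 2 n)} (≈.sym (poch-⟨-x,x⟩ n)))
      (everywhere (⊗-inverseʳ (poch (ℤ.- (+ 1)) 2 2 n) (prodPS-constant n λ j → refl)))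
  ; σ = alternate
  ; σ-cong = λ p → agree λ i i≤M → cong (sgn i ℤ.*_) (at p i i≤M)
  ; σ-+ = λ f g → everywhere λ i → ℤ.*-distribˡ-+ (sgn i) (f i) (g i)
  ; σ-* = λ f g → everywhere (alternate-⊗ f g)
  ; σ-1 = everywhere λ { zero → refl ; (suc i) → ℤ.*-zeroʳ (sgn (suc i)) }
  ; σ-q = everywhere λ { zero → refl ; (suc zero) → refl ; (suc (suc i)) → ℤ.*-zeroʳ (sgn (suc (suc i))) }
  }
  where
  open Sums (truncatedRing M) using (∏)
  open Products M
  module ≈ = CommutativeRing (truncatedRing M)

-- Each extra factor has exponent at least b + cn > i, hence is 1 up to q^i.
poch-extend : ∀ a b c k n i → i ℕ.< b ℕ.+ c ℕ.* n → poch a b c (k ℕ.+ n) i ≡ poch a b c n i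
poch-extend a b c zero    n i i<e = refl
poch-extend a b c (suc k) n i i<e = ≡.trans
  (at (*-congˡ {x = poch a b c (k ℕ.+ n)} factor≈1) i ℕ.≤-refl)
  (≡.trans (at (*-identityʳ (poch a b c (k ℕ.+ n))) i ℕ.≤-refl) (poch-extend a b c k n i i<e))
  where
  open CommutativeRing (truncatedRing i) using (*-congˡ; *-identityʳ)
  factor≈1 : one ⊖ mono a (b ℕ.+ c ℕ.* (k ℕ.+ n)) ≈[ i ] one
  factor≈1 = agree λ j j≤i → ≡.trans
    (cong (λ t → one j ℤ.+ ℤ.- t) (mono-< a (ℕ.≤-<-trans j≤i (ℕ.<-≤-trans i<e
      (ℕ.+-monoʳ-≤ b (ℕ.*-monoʳ-≤ c (ℕ.m≤n+m n k)))))))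
    (ℤ.+-identityʳ (one j))

-- Sieving by parity

parity : ∀ m → (m % 2 ≡ 0 × sgn m ≡ + 1) ⊎ (m % 2 ≡ 1 × sgn m ≡ -[1+ 0 ])
parity zero          = inj₁ (refl , refl)
parity (suc zero)    = inj₂ (refl , refl)
parity (suc (suc m)) with parity m
... | inj₁ (m%2≡0 , s) = inj₁ (m%2≡0 , ≡.trans (ℤ.neg-involutive (sgn m)) s)
... | inj₂ (m%2≡1 , s) = inj₂ (m%2≡1 , ≡.trans (ℤ.neg-involutive (sgn m)) s)

i≡-i⇒i≡0 : ∀ {i} → i ≡ ℤ.- i → i ≡ + 0
i≡-i⇒i≡0 {+ zero}  _ = refl
i≡-i⇒i≡0 {+ suc n} ()
i≡-i⇒i≡0 { -[1+ n ]} ()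

-- For even m the oddness of o gives o m = - o m, for odd m the evenness of e gives e m = - e m; ℤ
-- has no 2-torsion.
sieve-even : ∀ m {f e o} → f ≈[ m ] e ⊕ o → alternate e ≈[ m ] e → alternate o ≈[ m ] ⊝ o →
  sieve 2 0 f m ≡ e m
sieve-even m {f} {e} {o} f≈e+o σe≈e σo≈-o with m % 2 ℕ.≟ 0 | parity m
... | yes _     | inj₁ (_ , s) = ≡.trans (at f≈e+o m ℕ.≤-refl) (≡.trans (cong (λ t → e m ℤ.+ t) o≡0) (ℤ.+-identityʳ (e m)))
  where
  o≡0 : o m ≡ + 0
  o≡0 = i≡-i⇒i≡0 (≡.trans (≡.sym (≡.trans (cong (ℤ._* o m) s) (ℤ.*-identityˡ (o m)))) (at σo≈-o m ℕ.≤-refl))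
... | no  _     | inj₂ (_ , s) = ≡.sym (i≡-i⇒i≡0 (≡.trans (≡.sym (at σe≈e m ℕ.≤-refl))
  (≡.trans (cong (ℤ._* e m) s) (ℤ.-1*i≡-i (e m)))))
... | yes m%2≡0 | inj₂ (m%2≡1 , _) = ⊥-elim (0≢1 (≡.trans (≡.sym m%2≡0) m%2≡1))
  where
  0≢1 : 0 ≢ 1
  0≢1 ()
... | no  m%2≢0 | inj₁ (m%2≡0 , _) = ⊥-elim (m%2≢0 m%2≡0)

∣m⊖n∣≡∣m-n∣ : ∀ m n → ℤ.∣ m ℤ.⊖ n ∣ ≡ ℕ.∣ m - n ∣
∣m⊖n∣≡∣m-n∣ zero    zero    = refl
∣m⊖n∣≡∣m-n∣ zero    (suc n) = refl
∣m⊖n∣≡∣m-n∣ (suc m) zero    = refl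
∣m⊖n∣≡∣m-n∣ (suc m) (suc n) = ≡.trans (cong ℤ.∣_∣ (ℤ.[1+m]⊖[1+n]≡m⊖n m n)) (∣m⊖n∣≡∣m-n∣ m n)

∣+m-+n∣≡∣m-n∣ : ∀ m n → ℤ.∣ + m ℤ.- + n ∣ ≡ ℕ.∣ m - n ∣
∣+m-+n∣≡∣m-n∣ m n = ≡.trans (cong ℤ.∣_∣ (ℤ.m-n≡m⊖n m n)) (∣m⊖n∣≡∣m-n∣ m n)

S-term : ℕ → PS
S-term n = poch (+ 1) 1 2 n ⊗ poch (+ 1) 1 2 n ⊗ mono (+ 1) (2 ℕ.* n) ⊗ inv (poch (ℤ.- (+ 1)) 2 2 n)

S-term-small : ∀ {n i} → i ℕ.< n → S-term n i ≡ + 0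
S-term-small {n} {i} i<n = at (trans (*-congʳ {w} (trans (*-congˡ {p} small) (zeroʳ p))) (zeroˡ w)) i ℕ.≤-refl
  where
  open CommutativeRing (truncatedRing i) using (trans; *-congʳ; *-congˡ; zeroʳ; zeroˡ)
  p = poch (+ 1) 1 2 n ⊗ poch (+ 1) 1 2 n
  w = inv (poch (ℤ.- (+ 1)) 2 2 n)
  small : mono (+ 1) (2 ℕ.* n) ≈[ i ] zeroPS
  small = agree λ j j≤i → mono-< (+ 1) (ℕ.≤-<-trans j≤i (ℕ.<-≤-trans i<n (ℕ.m≤n*m n 2)))

-- Comparison of the given series with their truncations

module Truncation (M : ℕ) where
  open SeriesRing (seriesRing M) renaming (refl to ≈-refl; sym to ≈-sym; trans to ≈-trans)
  open Core (seriesRing M) using (N₀; S-summand; hecke-term; fold; fold-cong; sign; ∑-symmetric; parity-decomposition)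
  open Products M

  ∑-at : ∀ n F i → ∑ (suc n) F i ≡ sumTo (λ k → F k i) n
  ∑-at zero    F i = ℤ.+-identityˡ (F 0 i)
  ∑-at (suc n) F i = cong (ℤ._+ F (suc n) i) (∑-at n F i)

  poch-⟨q,q²⟩ : ∀ n → poch (+ 1) 1 2 n ≈ ⟨q,q²⟩ n
  poch-⟨q,q²⟩ n = prodPS-∏ n λ j → +-congˡ {x = one} (-‿cong (q^+ 1 (2 ℕ.* j)))

  poch-⟨x²,x²⟩ : ∀ n → poch (+ 1) 4 4 n ≈ ⟨x²,x²⟩ n
  poch-⟨x²,x²⟩ n = prodPS-∏ n λ j → reflexive (cong (λ e → one ⊖ mono (+ 1) e) (exponent j))
    where
    exponent : ∀ j → 4 ℕ.+ 4 ℕ.* j ≡ 2 ℕ.* (suc j ℕ.+ suc j)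
    exponent = solve-∀

  -- At coefficient i the series use i+1 factors or terms; this is the number still to be added to
  -- reach N₀.
  N₀-split : ∀ {i} → i ℕ.≤ M → (M ∸ i ℕ.+ suc M) ℕ.+ suc i ≡ N₀
  N₀-split {i} i≤M = ≡.trans (rearrange (M ∸ i) M i) (cong (λ t → suc t ℕ.+ suc M) (ℕ.m∸n+n≡m i≤M))
    where
    rearrange : ∀ r M i → (r ℕ.+ suc M) ℕ.+ suc i ≡ suc (r ℕ.+ i) ℕ.+ suc M
    rearrange = solve-∀

  pochInf-⟨x²,x²⟩ : pochInf (+ 1) 4 4 ≈ ⟨x²,x²⟩ N₀
  pochInf-⟨x²,x²⟩ = ≈-trans (agree λ i i≤M → ≡.sym (≡.trans
      (cong (λ n → poch (+ 1) 4 4 n i) (≡.sym (N₀-split i≤M)))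
      (poch-extend (+ 1) 4 4 (M ∸ i ℕ.+ suc M) (suc i) i
        (ℕ.≤-trans (ℕ.m≤n*m (suc i) 4) (ℕ.m≤n+m (4 ℕ.* suc i) 4)))))
    (poch-⟨x²,x²⟩ N₀)

  S-truncated : S ≈ ∑ N₀ S-summand
  S-truncated = ≈-trans
    (agree λ i i≤M → ≡.sym (≡.trans (cong (λ n → ∑ n S-term i) (≡.sym (≡.trans (≡.sym (ℕ.+-suc (M ∸ i ℕ.+ suc M) i)) (N₀-split i≤M))))
      (≡.trans (∑-at (M ∸ i ℕ.+ suc M ℕ.+ i) S-term i) (sumTo-extend (M ∸ i ℕ.+ suc M) i (λ n → S-term n i) λ n i<n → S-term-small i<n))))
    (∑-cong N₀ {S-term} {S-summand} λ n _ →
      *-congʳ {inv (poch (ℤ.- (+ 1)) 2 2 n)} (*-congʳ {mono (+ 1) (2 ℕ.* n)} (*-cong (poch-⟨q,q²⟩ n) (poch-⟨q,q²⟩ n))))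

  mono-sgn : ∀ n → mono (sgn n) 0 ≈ sign n
  mono-sgn zero    = q^0
  mono-sgn (suc n) = ≈-trans (everywhere (mono-neg (sgn n) 0)) (-‿cong (mono-sgn n))

  -- The given series keeps signs inside the coefficient of a monomial, the ring keeps them as
  -- elements; constant monomials mediate.
  mono-hecke : ∀ n j e → mono (sgn n ℤ.* sgn j) e ≈ sign n * sign j * q^ e
  mono-hecke n j e = ≈-trans
    (≈-trans (everywhere λ i → cong (λ a → mono a e i) (≡.sym (ℤ.*-identityʳ (sgn n ℤ.* sgn j))))
      (≈-sym (everywhere (mono-⊗ (sgn n ℤ.* sgn j) (+ 1) 0 e))))
    (*-congʳ {q^ e} (≈-trans (≈-sym (everywhere (mono-⊗ (sgn n) (sgn j) 0 0))) (*-cong (mono-sgn n) (mono-sgn j))))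

  innerTerm-fold : ∀ n → innerTerm n ≈ fold n (hecke-term n)
  innerTerm-fold n = ≈-trans
    (everywhere λ i → begin
      sumTo (λ k → t ℤ.∣ + k ℤ.- + n ∣ i) (2 ℕ.* n)
        ≡⟨ sumTo-cong (2 ℕ.* n) (λ k _ → cong (λ j → t j i) (∣+m-+n∣≡∣m-n∣ k n)) ⟩
      sumTo (λ k → t ℕ.∣ k - n ∣ i) (2 ℕ.* n)
        ≡⟨ cong (sumTo (λ k → t ℕ.∣ k - n ∣ i)) (cong (n ℕ.+_) (ℕ.+-identityʳ n)) ⟩
      sumTo (λ k → t ℕ.∣ k - n ∣ i) (n ℕ.+ n)
        ≡⟨ ∑-at (n ℕ.+ n) (λ k → t ℕ.∣ k - n ∣) i ⟨
      ∑ (suc (n ℕ.+ n)) (λ k → t ℕ.∣ k - n ∣) i ∎)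
    (≈-trans (∑-symmetric n t) (fold-cong n {t} {hecke-term n} λ j _ → mono-hecke n j ((6 ℕ.* n ℕ.* n ℕ.+ 4 ℕ.* n) ∸ (2 ℕ.* j ℕ.* j))))
    where
    t : ℕ → PS
    t j = mono (sgn n ℤ.* sgn j) ((6 ℕ.* n ℕ.* n ℕ.+ 4 ℕ.* n) ∸ (2 ℕ.* j ℕ.* j))

  RHS-term : ℕ → PS
  RHS-term n = (one ⊕ mono (+ 1) (4 ℕ.* n ℕ.+ 2)) ⊗ innerTerm n

  RHS-truncated : ∑ (suc M) (λ n → (one + q^ (4 ℕ.* n ℕ.+ 2)) * fold n (hecke-term n)) ≈ ∑ (suc M) RHS-term
  RHS-truncated = ∑-cong (suc M) λ n _ → *-congˡ {one ⊕ mono (+ 1) (4 ℕ.* n ℕ.+ 2)} (≈-sym (innerTerm-fold n))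

  -- Since the precision is the index of the coefficient, `RHS M` sums over n ≤ M, exactly the range
  -- of the truncated double sum.
  coefficient : LHS M ≡ RHS M
  coefficient = ≡.trans
    (sieve-even M (≈-trans (*-cong pochInf-⟨x²,x²⟩ S-truncated) (proj₂ (proj₂ (proj₂ parity-decomposition))))
      (proj₁ (proj₂ (proj₂ parity-decomposition))) (proj₁ (proj₂ parity-decomposition)))
    (≡.trans (at RHS-truncated M ℕ.≤-refl) (∑-at M RHS-term M))

theorem1p2 : (m : ℕ) → LHS m ≡ RHS m
theorem1p2 m = Truncation.coefficient m
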